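{- For every fixed integer $r\ge 2$, as $n\to\infty$, \[ \kappa_{r,2}(K_n)\sim \left(1-\frac1r\right)n, \] and for every fixed integer $\ell\ge 3$, \[ \kappa_{r,\ell}(K_n)\sim \frac{n}{\ell-1}. \]
   Context: $K_n$ is the complete graph on $n$ vertices. An $r$-edge-coloring is a map from the edge set to $[r]$ (not all colors need be used). A path is alternating if any two adjacent edges of it have different colors; the length of a path is its number of edges; paths between two vertices are internally disjoint if they share no vertices other than their endpoints. The alternating connectivity $\kappa_{r,\ell}(G)$ of a graph $G$ is the maximum $t$ such that there is an $r$-edge-coloring of $G$ in which every pair of distinct vertices is connected by $t$ internally disjoint alternating paths of length $\ell$. $f\sim g$ means $f/g\to1$. -}

module Defs where

open import Data.Nat using (ℕ; zero; suc; _+_; _*_; _∸_; _≤_)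
open import Data.Fin using (Fin)
open import Data.Product using (Σ; _×_; ∃-syntax)
open import Relation.Binary.PropositionalEquality using (_≡_; _≢_)

-- An r-edge-coloring of K_n: a symmetric assignment of colours in Fin r
-- to pairs of vertices (values on the diagonal u = u are irrelevant).
record Coloring (r n : ℕ) : Set where
  field
    col  : Fin n → Fin n → Fin r
    symm : ∀ u v → col u v ≡ col v u
open Coloring public

-- A path of length ℓ in K_n from u to v: vertices p 0, p 1, …, p ℓ
-- (values of p beyond ℓ are ignored), pairwise distinct.
record IsPath (n ℓ : ℕ) (u v : Fin n) (p : ℕ → Fin n) : Set where
  field
    start : p 0 ≡ u
    end   : p ℓ ≡ v
    inj   : ∀ a b → a ≤ ℓ → b ≤ ℓ → p a ≡ p b → a ≡ b

Alternating : ∀ {r n} → Coloring r n → (ℓ : ℕ) → (ℕ → Fin n) → Set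
Alternating c ℓ p =
  ∀ i → i + 2 ≤ ℓ → col c (p i) (p (suc i)) ≢ col c (p (suc i)) (p (suc (suc i)))

HasDisjointAltPaths : ∀ {r n} → Coloring r n → (ℓ t : ℕ) → Fin n → Fin n → Set
HasDisjointAltPaths {r} {n} c ℓ t u v =
  Σ (Fin t → ℕ → Fin n) λ P →
    (∀ j → IsPath n ℓ u v (P j) × Alternating c ℓ (P j)) ×
    (∀ j k → j ≢ k → ∀ a b → 1 ≤ a → a + 1 ≤ ℓ → 1 ≤ b → b + 1 ≤ ℓ →
       P j a ≢ P k b)

-- There is an r-edge-coloring of K_n in which every pair of distinct vertices
-- is joined by t internally disjoint alternating paths of length ℓ.
-- κ_{r,ℓ}(K_n) is the maximum t with Achievable r ℓ n t.
Achievable : (r ℓ n t : ℕ) → Set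
Achievable r ℓ n t =
  Σ (Coloring r n) λ c → ∀ u v → u ≢ v → HasDisjointAltPaths c ℓ t u v

-- "κ_{r,ℓ}(K_n) ∈ [lo, hi]" phrased via the defining maximum:
-- some t ≥ lo is achievable, and every achievable t is ≤ hi.
-- To avoid rationals the bounds are given as  A * lo' ≤ B * t  style
-- cross-multiplied inequalities, see KappaAsymp below.

-- κ_{r,ℓ}(K_n) ~ (p/q)·n  (q ≥ 1): for every ε = 1/m (m ≥ 1) there is N such
-- that for all n ≥ N,  (1 - 1/m)(p/q) n ≤ κ ≤ (1 + 1/m)(p/q) n, i.e.
--   (m-1) p n ≤ m q κ ≤ (m+1) p n.
KappaAsymp : (r ℓ p q : ℕ) → Set
KappaAsymp r ℓ p q =
  ∀ m → 1 ≤ m → ∃[ N ] ∀ n → N ≤ n →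
    (∃[ t ] (Achievable r ℓ n t × (m ∸ 1) * p * n ≤ m * q * t)) ×
    (∀ t → Achievable r ℓ n t → m * q * t ≤ (m + 1) * p * n)

{-# OPTIONS --safe #-}

-- Upper bounds. For ℓ ≥ 3 the t paths have t (ℓ - 1) distinct inner vertices. For ℓ = 2, by
-- Cauchy–Schwarz each w sees at most (1 - 1/r) n² ordered pairs (u , v) in two different
-- colours; average over the pairs.
--
-- Lower bound for ℓ ≥ 3. Give every vertex a row and two bits s, τ, and colour an edge by
-- s + s′ between different rows and by τ + τ′ inside a row. A path from u to v can then keep
-- all its inner vertices in one row avoiding u and v: the bits s of the first and last inner
-- vertex make the outer edges have prescribed colours and the bits τ do the same for the
-- other edges. Swapping the two colours along the path, or reversing all τ, yields four such
-- paths that visit each of the four kinds of vertices once at every position, so nearly all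
-- vertices are used.
--
-- Lower bound for ℓ = 2. A random colouring, derandomised edge by edge: with weights r + k for
-- a tie c(uw) = c(vw), k for a non-tie and 1 + k (the average) for an undecided w, some choice
-- of the next colour does not increase the sum over u ≠ v of the products over w. Hence every
-- pair has S ties with (1 + r/k) ^ S ≤ n² (1 + 1/k) ^ n, which forces S ≤ (1/r + o(1)) n as
-- k and then n grow.
module Submission where

open import Defs
open import Data.Nat using (ℕ; _≤_; _∸_)
open import Data.Product using (_×_)

open import Data.Bool.Base using (Bool; true; false; not; _∧_; _xor_; if_then_else_)
open import Data.Bool.Properties using (not-¬; xor-comm; xor-assoc; xor-same)
open import Data.Fin.Base
  using (Fin; zero; suc; toℕ; fromℕ<; inject≤; remQuot; punchIn; punchOut; splitAt; _↑ˡ_; _↑ʳ_)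
open import Data.Fin.Properties as Fin
  using (toℕ-injective; toℕ<n; toℕ-fromℕ<; fromℕ<-toℕ; injective⇒≤; inject≤-injective;
         punchIn-injective; punchInᵢ≢i; punchIn-punchOut; splitAt-↑ˡ; ↑ˡ-injective;
         *↔×; 2↔Bool; any?)
open import Data.List.Base using ([]; _∷_; allFin; cartesianProduct)
open import Data.List.Membership.Propositional using (_∈_)
open import Data.List.Membership.Propositional.Properties using (∈-allFin; ∈-cartesianProduct⁺)
open import Data.List.Relation.Unary.Any using (here; there)
open import Data.Maybe.Base using (Maybe; just; nothing)
open import Data.Nat.Base hiding (ℕ; _≤_; _∸_)
open import Data.Nat.DivMod using (_/_; m≡m%n+[m/n]*n; m%n<n; m/n*n≤m; m*n/n≡m; /-monoˡ-≤)
open import Data.Nat.Properties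
open import Data.Nat.Tactic.RingSolver using (solve-∀)
open import Data.Product.Base using (Σ; _,_; proj₁; proj₂; ∃-syntax)
open import Data.Product.Function.NonDependent.Propositional using (_×-↔_)
open import Data.Product.Properties using (≡-dec)
open import Data.Sum.Base using (_⊎_; inj₁; inj₂; [_,_]′)
open import Data.Vec.Functional using (Vector; removeAt)
open import Function.Base using (_∘_; const)
open import Function.Bundles using (_↔_; Inverse; Injection)
open import Function.Construct.Composition using (_↔-∘_)
open import Function.Construct.Identity using (↔-id)
open import Function.Definitions using (Injective)
open import Function.Properties.Inverse using (↔⇒↣; ↔-sym)
open import Relation.Binary.Definitions using (DecidableEquality)
open import Relation.Binary.PropositionalEquality
  using (_≡_; _≢_; refl; sym; trans; cong; cong₂; subst; module ≡-Reasoning)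
open import Relation.Nullary using (Dec; yes; no; contradiction)
open import Relation.Nullary.Decidable using (does; dec-true; dec-false; ¬?; _×-dec_; _⊎-dec_)

open import Algebra.Properties.Semiring.Sum +-*-semiring
  using (sum; ∑-distrib-+; ∑-comm; sum-cong-≗; *-distribˡ-sum; *-distribʳ-sum)
open import Algebra.Properties.CommutativeMonoid.Sum *-1-commutativeMonoid
  using () renaming (sum to product; sum-remove to product-remove; sum-cong-≗ to product-cong)

-- Paths of length at least 3

-- The inner vertices are distinct within one path by `IsPath.inj` and across two paths by
-- disjointness. A path with `suc ℓ` edges has `ℓ` of them.
disjointPaths-bound : ∀ {r n} (c : Coloring r n) ℓ t {u v} →
  HasDisjointAltPaths c (suc ℓ) t u v → t * ℓ ≤ n
disjointPaths-bound c ℓ t (P , path , disjoint) = injective⇒≤ inner-injective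
  where
  inner : Fin (t * ℓ) → Fin _
  inner x = P (proj₁ (remQuot {t} ℓ x)) (suc (toℕ (proj₂ (remQuot {t} ℓ x))))

  pair-injective : ∀ (j k : Fin t) (a b : Fin ℓ) →
    P j (suc (toℕ a)) ≡ P k (suc (toℕ b)) → (j , a) ≡ (k , b)
  pair-injective j k a b eq with j Fin.≟ k
  ... | yes refl = cong (j ,_) (toℕ-injective (suc-injective
          (IsPath.inj (proj₁ (path j)) _ _ (s≤s (<⇒≤ (toℕ<n a))) (s≤s (<⇒≤ (toℕ<n b))) eq)))
  ... | no j≢k = contradiction eq (disjoint j k j≢k _ _ (s≤s z≤n) (inside a) (s≤s z≤n) (inside b))
    where
    inside : ∀ (a : Fin ℓ) → suc (toℕ a) + 1 ≤ suc ℓ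
    inside a = ≤-trans (≤-reflexive (+-comm (suc (toℕ a)) 1)) (s≤s (toℕ<n a))

  inner-injective : Injective _≡_ _≡_ inner
  inner-injective eq = Injection.injective (↔⇒↣ (*↔× {t} {ℓ})) (pair-injective _ _ _ _ eq)

-- An embedding whose image misses `p` and `q`. If the two coincide, one further arbitrary value is
-- skipped, so that the domain is `Fin k` in both cases.
avoid : ∀ {k} (p q : Fin (2 + k)) → Fin k → Fin (2 + k)
avoid p q x with p Fin.≟ q
... | yes _  = punchIn p (punchIn zero x)
... | no p≢q = punchIn p (punchIn (punchOut p≢q) x)

avoid-injective : ∀ {k} (p q : Fin (2 + k)) → Injective _≡_ _≡_ (avoid p q)
avoid-injective p q eq with p Fin.≟ q
... | yes _  = punchIn-injective zero _ _ (punchIn-injective p _ _ eq)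
... | no p≢q = punchIn-injective (punchOut p≢q) _ _ (punchIn-injective p _ _ eq)

avoid-≢ˡ : ∀ {k} (p q : Fin (2 + k)) x → p ≢ avoid p q x
avoid-≢ˡ p q x with p Fin.≟ q
... | yes _  = punchInᵢ≢i p _ ∘ sym
... | no p≢q = punchInᵢ≢i p _ ∘ sym

avoid-≢ʳ : ∀ {k} (p q : Fin (2 + k)) x → avoid p q x ≢ q
avoid-≢ʳ p q x with p Fin.≟ q
... | yes p≡q = λ eq → punchInᵢ≢i p _ (trans eq (sym p≡q))
... | no p≢q  = λ eq → punchInᵢ≢i (punchOut p≢q) x
        (punchIn-injective p _ _ (trans eq (sym (punchIn-punchOut p≢q))))

bits↔ : Fin (2 * 2) ↔ (Bool × Bool)
bits↔ = (2↔Bool ×-↔ 2↔Bool) ↔-∘ *↔× {2} {2}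

odd : ℕ → Bool
odd zero    = false
odd (suc a) = not (odd a)

-- The parity of the triangular number a(a+1)/2. Its consecutive values add up to `odd (suc a)`, an
-- alternating sequence.
oddTriangle : ℕ → Bool
oddTriangle zero    = false
oddTriangle (suc a) = oddTriangle a xor odd (suc a)

-- The construction for long paths needs two colours only, placed inside any larger palette.
bit : ∀ {r} → Bool → Fin (2 + r)
bit false = zero
bit true  = suc zero

bit-injective : ∀ {r} → Injective _≡_ _≡_ (bit {r})
bit-injective {_} {false} {false} _ = refl
bit-injective {_} {true}  {true}  _ = refl

xor-cancelˡ : ∀ a {b c} → a xor b ≡ a xor c → b ≡ c
xor-cancelˡ false eq = eq
xor-cancelˡ true {false} {false} eq = refl
xor-cancelˡ true {true}  {true}  eq = refl

data Position (L : ℕ) : ℕ → Set where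
  first : Position L 0
  inner : (a : Fin (suc L)) → Position L (suc (toℕ a))
  last  : Position L (2 + L)

innerPosition : ∀ {L a} → a < suc L → Position L (suc a)
innerPosition a<1+L = subst (Position _ ∘ suc) (toℕ-fromℕ< a<1+L) (inner (fromℕ< a<1+L))

position : ∀ {L a} → a ≤ 2 + L → Position L a
position {a = zero}  _           = first
position {a = suc a} (s≤s a≤1+L) with m≤n⇒m<n∨m≡n a≤1+L
... | inj₁ a<1+L = innerPosition a<1+L
... | inj₂ refl  = last

module Through {n L : ℕ} (u v : Fin n) (V : Fin (suc L) → Fin n) where

  -- Every index after the inner vertices yields `v`; `IsPath` inspects indices up to `2 + L` only.
  through : ℕ → Fin n
  through zero = u
  through (suc a) with a <? suc L
  ... | yes a<1+L = V (fromℕ< a<1+L)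
  ... | no  _     = v

  through-inner : ∀ a → through (suc (toℕ a)) ≡ V a
  through-inner a with toℕ a <? suc L
  ... | yes a<1+L = cong V (fromℕ<-toℕ a a<1+L)
  ... | no  a≮1+L = contradiction (toℕ<n a) a≮1+L

  through-end : through (2 + L) ≡ v
  through-end with suc L <? suc L
  ... | yes L<L = contradiction L<L (<-irrefl refl)
  ... | no  _   = refl

  through-isPath : u ≢ v → Injective _≡_ _≡_ V → (∀ a → u ≢ V a) → (∀ a → V a ≢ v) →
    IsPath n (2 + L) u v through
  through-isPath u≢v V-inj u≢V V≢v = record
    { start = refl
    ; end   = through-end
    ; inj   = λ a b a≤ b≤ → distinct (position a≤) (position b≤)
    }
    where
    distinct : ∀ {a b} → Position L a → Position L b → through a ≡ through b → a ≡ b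
    distinct first     first     _  = refl
    distinct first     (inner b) eq = contradiction (trans eq (through-inner b)) (u≢V b)
    distinct first     last      eq = contradiction (trans eq through-end) u≢v
    distinct (inner a) first     eq = contradiction (trans (sym eq) (through-inner a)) (u≢V a)
    distinct (inner a) (inner b) eq =
      cong (suc ∘ toℕ) (V-inj (trans (sym (through-inner a)) (trans eq (through-inner b))))
    distinct (inner a) last      eq =
      contradiction (trans (sym (through-inner a)) (trans eq through-end)) (V≢v a)
    distinct last      first     eq = contradiction (trans (sym eq) through-end) u≢v
    distinct last      (inner b) eq =
      contradiction (trans (sym (through-inner b)) (trans (sym eq) through-end)) (V≢v b)
    distinct last      last      _  = refl

-- Of the `2 + k` rows, `k` remain available for any two endpoints. Each row holds `J` copies of
-- every kind of vertex for every inner position, and `d` vertices are left over by rounding.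
module Rows (k l J d r : ℕ) where

  Row Copy Label Index Slot : Set
  Row   = Fin (2 + k)
  Copy  = Fin J
  -- The two bits decide the colours between different rows and inside a row, respectively.
  Label = (Bool × Bool) × Row
  Index = (Bool × Bool) × (Fin k × Copy)
  Slot  = (Bool × Bool) × (Row × (Fin (2 + l) × Copy))

  size paths : ℕ
  size  = 2 * 2 * ((2 + k) * ((2 + l) * J))
  paths = 2 * 2 * (k * J)

  slot↔ : Fin size ↔ Slot
  slot↔ = (bits↔ ×-↔ ((↔-id _ ×-↔ *↔×) ↔-∘ *↔×)) ↔-∘ *↔×

  index↔ : Fin paths ↔ Index
  index↔ = (bits↔ ×-↔ *↔×) ↔-∘ *↔×

  label : Slot → Label
  label (bits , row , _) = bits , row

  -- The `d` leftover vertices receive a default label: they are never inner vertices, but they do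
  -- occur as endpoints.
  vertexLabel : Fin (size + d) → Label
  vertexLabel x = [ label ∘ Inverse.to slot↔ , const ((false , false) , zero) ]′ (splitAt size x)

  vertex : Slot → Fin (size + d)
  vertex x = Inverse.from slot↔ x ↑ˡ d

  vertexLabel-vertex : ∀ x → vertexLabel (vertex x) ≡ label x
  vertexLabel-vertex x
    rewrite splitAt-↑ˡ size (Inverse.from slot↔ x) d = cong label (Inverse.strictlyInverseˡ slot↔ x)

  vertex-injective : Injective _≡_ _≡_ vertex
  vertex-injective eq = Injection.injective (↔⇒↣ (↔-sym slot↔)) (↑ˡ-injective d _ _ eq)

  hue : Label → Label → Bool
  hue ((s , τ) , i) ((s′ , τ′) , i′) = if does (i Fin.≟ i′) then τ xor τ′ else s xor s′

  hue-sym : ∀ x y → hue x y ≡ hue y x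
  hue-sym ((s , τ) , i) ((s′ , τ′) , i′) with i Fin.≟ i′ | i′ Fin.≟ i
  ... | yes _    | yes _    = xor-comm τ τ′
  ... | no _     | no _     = xor-comm s s′
  ... | yes i≡i′ | no i′≢i  = contradiction (sym i≡i′) i′≢i
  ... | no i≢i′  | yes i′≡i = contradiction (sym i′≡i) i≢i′

  hue-sameRow : ∀ x y → proj₂ x ≡ proj₂ y → hue x y ≡ proj₂ (proj₁ x) xor proj₂ (proj₁ y)
  hue-sameRow (_ , i) (_ , i′) i≡i′ rewrite dec-true (i Fin.≟ i′) i≡i′ = refl

  hue-differentRows : ∀ x y → proj₂ x ≢ proj₂ y → hue x y ≡ proj₁ (proj₁ x) xor proj₁ (proj₁ y)
  hue-differentRows (_ , i) (_ , i′) i≢i′ rewrite dec-false (i Fin.≟ i′) i≢i′ = refl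

  coloring : Coloring (2 + r) (size + d)
  coloring = record
    { col  = λ x y → bit (hue (vertexLabel x) (vertexLabel y))
    ; symm = λ x y → cong bit (hue-sym (vertexLabel x) (vertexLabel y))
    }

  module Between (u v : Fin (size + d)) (u≢v : u ≢ v) where

    rowᵘ rowᵛ : Row
    rowᵘ = proj₂ (vertexLabel u)
    rowᵛ = proj₂ (vertexLabel v)

    sideᵘ sideᵛ : Bool
    sideᵘ = proj₁ (proj₁ (vertexLabel u))
    sideᵛ = proj₁ (proj₁ (vertexLabel v))

    -- Position 0 is tuned to the edge leaving `u` and the last position to the edge entering `v`.
    -- These positions differ because there are at least two inner vertices. In between, the edges
    -- read the other bit, so any value serves.
    side : Fin (2 + l) → Bool
    side zero    = sideᵘ
    side (suc _) = sideᵛ xor odd (2 + l)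

    -- The solution of the recurrence that makes two consecutive levels add up to the prescribed hue
    -- `odd (suc a) xor σ`.
    level : Bool → ℕ → Bool
    level σ a = oddTriangle a xor (odd a ∧ σ)

    -- `σ` swaps the two colours along the path and `β` reverses all levels. The position is stored
    -- in the slot, so different positions never compete for a vertex.
    slot : Index → Fin (2 + l) → Slot
    slot ((σ , β) , i , j) a =
      (side a xor σ , level σ (toℕ a) xor β) , avoid rowᵘ rowᵛ i , a , j

    -- The position is read off first. Once it is known, cancelling `side a` recovers `σ`, and then
    -- cancelling `level` recovers `β`.
    slot-injective : ∀ {x y a b} → slot x a ≡ slot y b → x ≡ y × a ≡ b
    slot-injective {(σ , β) , i , j} {(σ′ , β′) , i′ , j′} {a} eq
      with refl ← cong (proj₁ ∘ proj₂ ∘ proj₂) eq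
      with refl ← xor-cancelˡ (side a) (cong (proj₁ ∘ proj₁) eq)
      with refl ← xor-cancelˡ (level σ (toℕ a)) (cong (proj₂ ∘ proj₁) eq)
      with refl ← avoid-injective rowᵘ rowᵛ (cong (proj₁ ∘ proj₂) eq)
      with refl ← cong (proj₂ ∘ proj₂ ∘ proj₂) eq = refl , refl

    V : Index → Fin (2 + l) → Fin (size + d)
    V x a = vertex (slot x a)

    V-injective : ∀ {x y a b} → V x a ≡ V y b → x ≡ y × a ≡ b
    V-injective = slot-injective ∘ vertex-injective

    u≢V : ∀ x a → u ≢ V x a
    u≢V x@(_ , i , _) a eq = avoid-≢ˡ rowᵘ rowᵛ i
      (cong proj₂ (trans (cong vertexLabel eq) (vertexLabel-vertex (slot x a))))

    V≢v : ∀ x a → V x a ≢ v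
    V≢v x@(_ , i , _) a eq = avoid-≢ʳ rowᵘ rowᵛ i
      (cong proj₂ (trans (sym (vertexLabel-vertex (slot x a))) (cong vertexLabel eq)))

    -- `β` cancels, and exactly one of `a` and `suc a` is odd, so a single `σ` survives.
    level-step : ∀ σ β a → (level σ a xor β) xor (level σ (suc a) xor β) ≡ odd (suc a) xor σ
    level-step σ β a with oddTriangle a | odd a | σ | β
    ... | false | false | false | false = refl
    ... | false | false | false | true  = refl
    ... | false | false | true  | false = refl
    ... | false | false | true  | true  = refl
    ... | false | true  | false | false = refl
    ... | false | true  | false | true  = refl
    ... | false | true  | true  | false = refl
    ... | false | true  | true  | true  = refl
    ... | true  | false | false | false = refl
    ... | true  | false | false | true  = refl
    ... | true  | false | true  | false = refl
    ... | true  | false | true  | true  = refl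
    ... | true  | true  | false | false = refl
    ... | true  | true  | false | true  = refl
    ... | true  | true  | true  | false = refl
    ... | true  | true  | true  | true  = refl

    module _ (x : Index) where
      open Through u v (V x)

      private
        σ β : Bool
        σ = proj₁ (proj₁ x)
        β = proj₂ (proj₁ x)

        row : Row
        row = avoid rowᵘ rowᵛ (proj₁ (proj₂ x))

        inRow : Bool → ℕ → Label
        inRow s a = (s xor σ , level σ a xor β) , row

      labelAt : ∀ {a} (a<2+l : a < 2 + l) →
        vertexLabel (through (suc a)) ≡ inRow (side (fromℕ< a<2+l)) a
      labelAt {a} a<2+l = begin
        vertexLabel (through (suc a))         ≡⟨ cong (vertexLabel ∘ through ∘ suc) (toℕ-fromℕ< a<2+l) ⟨
        vertexLabel (through (suc (toℕ a′)))  ≡⟨ cong vertexLabel (through-inner a′) ⟩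
        vertexLabel (V x a′)                  ≡⟨ vertexLabel-vertex (slot x a′) ⟩
        inRow (side a′) (toℕ a′)              ≡⟨ cong (inRow (side a′)) (toℕ-fromℕ< a<2+l) ⟩
        inRow (side a′) a                     ∎
        where
        open ≡-Reasoning
        a′ = fromℕ< a<2+l

      hueAt : ℕ → Bool
      hueAt e = hue (vertexLabel (through e)) (vertexLabel (through (suc e)))

      -- The cases are the edge leaving `u`, the edges inside the row and the edge entering `v`. The
      -- first and last read `side`, the others read `level`.
      hueAt≡ : ∀ e → e ≤ 2 + l → hueAt e ≡ odd e xor σ
      hueAt≡ zero _ = begin
        hue (vertexLabel u) (vertexLabel (through 1))
          ≡⟨ cong (hue (vertexLabel u)) (labelAt z<s) ⟩
        hue (vertexLabel u) (inRow sideᵘ 0)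
          ≡⟨ hue-differentRows (vertexLabel u) (inRow sideᵘ 0) (avoid-≢ˡ rowᵘ rowᵛ (proj₁ (proj₂ x))) ⟩
        sideᵘ xor (sideᵘ xor σ)
          ≡⟨ xor-assoc sideᵘ sideᵘ σ ⟨
        (sideᵘ xor sideᵘ) xor σ
          ≡⟨ cong (_xor σ) (xor-same sideᵘ) ⟩
        σ ∎
        where open ≡-Reasoning
      hueAt≡ (suc a) (s≤s a≤1+l) with m≤n⇒m<n∨m≡n a≤1+l
      ... | inj₁ a<1+l = begin
        hueAt (suc a)
          ≡⟨ cong₂ hue (labelAt (m<n⇒m<1+n a<1+l)) (labelAt (s≤s a<1+l)) ⟩
        hue (inRow s a) (inRow s′ (suc a))
          ≡⟨ hue-sameRow (inRow s a) (inRow s′ (suc a)) refl ⟩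
        (level σ a xor β) xor (level σ (suc a) xor β)
          ≡⟨ level-step σ β a ⟩
        odd (suc a) xor σ ∎
        where
        open ≡-Reasoning
        s s′ : Bool
        s  = side (fromℕ< (m<n⇒m<1+n a<1+l))
        s′ = side (fromℕ< (s≤s a<1+l))
      ... | inj₂ refl = begin
        hueAt (2 + l)
          ≡⟨ cong₂ hue (labelAt ≤-refl) (cong vertexLabel through-end) ⟩
        hue (inRow (sideᵛ xor odd (2 + l)) (suc l)) (vertexLabel v)
          ≡⟨ hue-differentRows (inRow (sideᵛ xor odd (2 + l)) (suc l)) (vertexLabel v) (avoid-≢ʳ rowᵘ rowᵛ (proj₁ (proj₂ x))) ⟩
        ((sideᵛ xor odd (2 + l)) xor σ) xor sideᵛ
          ≡⟨ xor-comm _ sideᵛ ⟩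
        sideᵛ xor ((sideᵛ xor odd (2 + l)) xor σ)
          ≡⟨ cong (sideᵛ xor_) (xor-assoc sideᵛ (odd (2 + l)) σ) ⟩
        sideᵛ xor (sideᵛ xor (odd (2 + l) xor σ))
          ≡⟨ xor-assoc sideᵛ sideᵛ _ ⟨
        (sideᵛ xor sideᵛ) xor (odd (2 + l) xor σ)
          ≡⟨ cong (_xor (odd (2 + l) xor σ)) (xor-same sideᵛ) ⟩
        odd (2 + l) xor σ ∎
        where open ≡-Reasoning

      through-alternating : Alternating coloring (3 + l) through
      through-alternating e e+2≤3+l eq = not-¬ refl (xor-cancelˡ σ (begin
        σ xor odd e        ≡⟨ xor-comm σ (odd e) ⟩
        odd e xor σ        ≡⟨ hueAt≡ e (≤-trans (n≤1+n e) e<2+l) ⟨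
        hueAt e            ≡⟨ bit-injective eq ⟩
        hueAt (suc e)      ≡⟨ hueAt≡ (suc e) e<2+l ⟩
        odd (suc e) xor σ  ≡⟨ xor-comm (odd (suc e)) σ ⟩
        σ xor odd (suc e)  ∎))
        where
        open ≡-Reasoning
        e<2+l : e < 2 + l
        e<2+l = s≤s⁻¹ (subst (_≤ 3 + l) (+-comm e 2) e+2≤3+l)

    disjointPaths : HasDisjointAltPaths coloring (3 + l) paths u v
    disjointPaths = through ∘ index
      , (λ j → through-isPath u≢v (proj₂ ∘ V-injective {index j}) (u≢V _) (V≢v _) , through-alternating (index j))
      , λ j k j≢k a b 1≤a a+1≤ 1≤b b+1≤ →
          disjoint j≢k (innerOf 1≤a a+1≤) (innerOf 1≤b b+1≤)
      where
      index : Fin paths → Index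
      index = Inverse.to index↔

      through : Index → ℕ → Fin (size + d)
      through x = Through.through u v (V x)
      open module T {x} = Through u v (V x) using (through-inner; through-isPath)

      innerOf : ∀ {a} → 1 ≤ a → a + 1 ≤ 3 + l → ∃[ a′ ] a ≡ suc (toℕ {2 + l} a′)
      innerOf {suc a} _ a+1≤3+l = fromℕ< a<2+l , cong suc (sym (toℕ-fromℕ< a<2+l))
        where
        a<2+l : a < 2 + l
        a<2+l = s≤s⁻¹ (subst (_≤ 3 + l) (+-comm (suc a) 1) a+1≤3+l)

      disjoint : ∀ {j k a b} → j ≢ k → (∃[ a′ ] a ≡ suc (toℕ {2 + l} a′)) →
        (∃[ b′ ] b ≡ suc (toℕ {2 + l} b′)) → through (index j) a ≢ through (index k) b
      disjoint j≢k (a , refl) (b , refl) eq = j≢k (Injection.injective (↔⇒↣ index↔)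
        (proj₁ (V-injective {a = a} {b} (trans (sym (through-inner a)) (trans eq (through-inner b))))))

longPaths-achievable : ∀ k l J d r →
  Achievable (2 + r) (3 + l) (2 * 2 * ((2 + k) * ((2 + l) * J)) + d) (2 * 2 * (k * J))
longPaths-achievable k l J d r =
  Rows.coloring k l J d r , Rows.Between.disjointPaths k l J d r

twoVertices : ∀ {n} → 2 ≤ n → Σ (Fin n) λ u → ∃[ v ] u ≢ v
twoVertices (s≤s (s≤s _)) = zero , suc zero , λ ()

-- Asymptotics for length at least 3

longPaths-asymp : ∀ r l → KappaAsymp (2 + r) (3 + l) 1 (2 + l)
longPaths-asymp r l (suc m′) _ = N , λ n N≤n → lower n N≤n , upper n N≤n
  where
  m k L D N : ℕ
  m = suc m′
  -- Two of the `2 + k` rows are lost to the endpoints, and less than one block of `D` vertices to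
  -- rounding. With `k = 4 * m` and at least `2 * m` blocks, each loss is below a fraction 1/(2m).
  k = 4 * m
  L = 2 + l
  D = 2 * 2 * ((2 + k) * L)
  N = 2 * m * D

  arithmetic : ∀ J → 2 * m ≤ J → m′ * ((2 + k) * (1 + J)) ≤ m * (k * J)
  arithmetic J 2m≤J = begin
    m′ * ((2 + 4 * m) * (1 + J))                      ≡⟨ expand m′ J ⟩
    (4 * m′ * m′ + 6 * m′) * J + m′ * (4 * m′ + 6)    ≤⟨ +-monoʳ-≤ ((4 * m′ * m′ + 6 * m′) * J) small ⟩
    (4 * m′ * m′ + 6 * m′) * J + (2 * m′ + 4) * J     ≡⟨ collect m′ J ⟩
    m * (4 * m * J)                                   ∎
    where
    open ≤-Reasoning
    expand : ∀ x J → x * ((2 + 4 * (1 + x)) * (1 + J)) ≡ (4 * x * x + 6 * x) * J + x * (4 * x + 6)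
    expand = solve-∀
    collect : ∀ x J → (4 * x * x + 6 * x) * J + (2 * x + 4) * J ≡ (1 + x) * (4 * (1 + x) * J)
    collect = solve-∀
    square : ∀ x → x * (4 * x + 6) + (6 * x + 8) ≡ (2 * x + 4) * (2 * (1 + x))
    square = solve-∀
    small : m′ * (4 * m′ + 6) ≤ (2 * m′ + 4) * J
    small = begin
      m′ * (4 * m′ + 6)                 ≤⟨ m≤m+n _ (6 * m′ + 8) ⟩
      m′ * (4 * m′ + 6) + (6 * m′ + 8)  ≡⟨ square m′ ⟩
      (2 * m′ + 4) * (2 * m)            ≤⟨ *-monoʳ-≤ (2 * m′ + 4) 2m≤J ⟩
      (2 * m′ + 4) * J                  ∎

  lower : ∀ n → N ≤ n → ∃[ t ] (Achievable (2 + r) (3 + l) n t × m′ * 1 * n ≤ m * L * t)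
  lower n N≤n = 2 * 2 * (k * J)
    , subst (λ n → Achievable (2 + r) (3 + l) n (2 * 2 * (k * J))) (m+[n∸m]≡n size≤n)
        (longPaths-achievable k l J (n ∸ size) r)
    , (begin
    m′ * 1 * n                                    ≤⟨ *-monoʳ-≤ (m′ * 1) n≤[1+J]D ⟩
    m′ * 1 * ((1 + J) * D)                        ≡⟨ regroup m′ k L J ⟩
    2 * 2 * L * (m′ * ((2 + k) * (1 + J)))        ≤⟨ *-monoʳ-≤ (2 * 2 * L) (arithmetic J 2m≤J) ⟩
    2 * 2 * L * (m * (k * J))                     ≡⟨ regroup′ m k L J ⟩
    m * L * (2 * 2 * (k * J))                     ∎)
    where
    open ≤-Reasoning
    J size : ℕ
    J = n / D
    size = 2 * 2 * ((2 + k) * (L * J))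
    regroup : ∀ x k L J → x * 1 * ((1 + J) * (2 * 2 * ((2 + k) * L))) ≡ 2 * 2 * L * (x * ((2 + k) * (1 + J)))
    regroup = solve-∀
    regroup′ : ∀ m k L J → 2 * 2 * L * (m * (k * J)) ≡ m * L * (2 * 2 * (k * J))
    regroup′ = solve-∀
    size≡ : ∀ k L J → 2 * 2 * ((2 + k) * (L * J)) ≡ J * (2 * 2 * ((2 + k) * L))
    size≡ = solve-∀
    size≤n : size ≤ n
    size≤n = ≤-trans (≤-reflexive (size≡ k L J)) (m/n*n≤m n D)
    n≤[1+J]D : n ≤ (1 + J) * D
    n≤[1+J]D = ≤-trans (≤-reflexive (m≡m%n+[m/n]*n n D)) (+-monoˡ-≤ (J * D) (<⇒≤ (m%n<n n D)))
    2m≤J : 2 * m ≤ J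
    2m≤J = ≤-trans (≤-reflexive (sym (m*n/n≡m (2 * m) D))) (/-monoˡ-≤ D N≤n)

  2≤N : 2 ≤ N
  2≤N = *-mono-≤ {2} {2 * m} {1} {D} (m≤m*n 2 m) (s≤s z≤n)

  upper : ∀ n → N ≤ n → ∀ t → Achievable (2 + r) (3 + l) n t → m * L * t ≤ (m + 1) * 1 * n
  upper n N≤n t (c , achieves) with u , v , u≢v ← twoVertices (≤-trans 2≤N N≤n) = begin
    m * L * t        ≡⟨ regroup m L t ⟩
    m * (t * L)      ≤⟨ *-monoʳ-≤ m (disjointPaths-bound c L t (achieves u v u≢v)) ⟩
    m * n            ≤⟨ *-monoˡ-≤ n (m≤m+n m 1) ⟩
    (m + 1) * n      ≡⟨ cong (_* n) (*-identityʳ (m + 1)) ⟨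
    (m + 1) * 1 * n  ∎
    where
    open ≤-Reasoning
    regroup : ∀ m L t → m * L * t ≡ m * (t * L)
    regroup = solve-∀

-- Sums and counting

sum-mono-≤ : ∀ {n} {f g : Vector ℕ n} → (∀ i → f i ≤ g i) → sum f ≤ sum g
sum-mono-≤ {zero}  f≤g = z≤n
sum-mono-≤ {suc n} f≤g = +-mono-≤ (f≤g zero) (sum-mono-≤ (f≤g ∘ suc))

product-mono-≤ : ∀ {n} {f g : Vector ℕ n} → (∀ i → f i ≤ g i) → product f ≤ product g
product-mono-≤ {zero}  f≤g = s≤s z≤n
product-mono-≤ {suc n} f≤g = *-mono-≤ (f≤g zero) (product-mono-≤ (f≤g ∘ suc))

sum-const : ∀ n x → sum {n} (const x) ≡ n * x
sum-const zero    x = refl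
sum-const (suc n) x = cong (x +_) (sum-const n x)

product-const : ∀ n x → product {n} (const x) ≡ x ^ n
product-const zero    x = refl
product-const (suc n) x = cong (x *_) (product-const n x)

≤-sum : ∀ {n} (f : Vector ℕ n) i → f i ≤ sum f
≤-sum f zero    = m≤m+n (f zero) _
≤-sum f (suc i) = ≤-trans (≤-sum (f ∘ suc) i) (m≤n+m _ (f zero))

𝟙 : Bool → ℕ
𝟙 true  = 1
𝟙 false = 0

𝟙-not : ∀ b → 𝟙 b + 𝟙 (not b) ≡ 1
𝟙-not true  = refl
𝟙-not false = refl

count : ∀ {n} → (Fin n → Bool) → ℕ
count p = sum (𝟙 ∘ p)

count-not : ∀ {n} (p : Fin n → Bool) → count p + count (not ∘ p) ≡ n
count-not {n} p = begin
  count p + count (not ∘ p)                 ≡⟨ ∑-distrib-+ (𝟙 ∘ p) (𝟙 ∘ not ∘ p) ⟨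
  sum (λ i → 𝟙 (p i) + 𝟙 (not (p i)))       ≡⟨ sum-cong-≗ (𝟙-not ∘ p) ⟩
  sum {n} (const 1)                         ≡⟨ sum-const n 1 ⟩
  n * 1                                     ≡⟨ *-identityʳ n ⟩
  n                                         ∎
  where open ≡-Reasoning

product-if : ∀ {n} (p : Fin n → Bool) x y →
  product (λ i → if p i then x else y) ≡ x ^ count p * y ^ count (not ∘ p)
product-if {zero}  p x y = refl
product-if {suc n} p x y with p zero
... | true  = trans (cong (x *_) (product-if (p ∘ suc) x y))
                    (sym (*-assoc x (x ^ count (p ∘ suc)) (y ^ count (not ∘ p ∘ suc))))
... | false = trans (cong (y *_) (product-if (p ∘ suc) x y))
                    (exchange y (x ^ count (p ∘ suc)) (y ^ count (not ∘ p ∘ suc)))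
  where
  exchange : ∀ a b c → a * (b * c) ≡ b * (a * c)
  exchange = solve-∀

-- Stated for an arbitrary `b` so that matching on it evaluates the leading summand of `count p`.
rankHead : ∀ b {m} → b ≡ true → Fin (𝟙 b + m)
rankHead true _ = zero

rankHead≢↑ʳ : ∀ b {m} (b≡true : b ≡ true) (i : Fin m) → rankHead b b≡true ≢ 𝟙 b ↑ʳ i
rankHead≢↑ʳ true _ _ ()

rank : ∀ {n} (p : Fin n → Bool) i → p i ≡ true → Fin (count p)
rank p zero    pi = rankHead (p zero) pi
rank p (suc i) pi = 𝟙 (p zero) ↑ʳ rank (p ∘ suc) i pi

rank-injective : ∀ {n} (p : Fin n → Bool) i j (pi : p i ≡ true) (pj : p j ≡ true) →
  rank p i pi ≡ rank p j pj → i ≡ j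
rank-injective p zero    zero    pi pj eq = refl
rank-injective p zero    (suc j) pi pj eq = contradiction eq (rankHead≢↑ʳ (p zero) pi _)
rank-injective p (suc i) zero    pi pj eq = contradiction (sym eq) (rankHead≢↑ʳ (p zero) pj _)
rank-injective p (suc i) (suc j) pi pj eq =
  cong suc (rank-injective (p ∘ suc) i j pi pj (Fin.↑ʳ-injective (𝟙 (p zero)) _ _ eq))

injective⇒≤count : ∀ {t n} (p : Fin n → Bool) (f : Fin t → Fin n) → Injective _≡_ _≡_ f →
  (∀ j → p (f j) ≡ true) → t ≤ count p
injective⇒≤count p f f-inj pf =
  injective⇒≤ {f = λ j → rank p (f j) (pf j)} (f-inj ∘ rank-injective p _ _ (pf _) (pf _))

-- The converse direction to `injective⇒≤count`: it turns a count of suitable vertices into distinct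
-- middle vertices.
select : ∀ {n} (p : Fin n → Bool) → Fin (count p) → Fin n
select {suc n} p i with p zero
select {suc n} p zero    | true  = zero
select {suc n} p (suc i) | true  = suc (select (p ∘ suc) i)
select {suc n} p i       | false = suc (select (p ∘ suc) i)

select-true : ∀ {n} (p : Fin n → Bool) i → p (select p i) ≡ true
select-true {suc n} p i with p zero in p₀
select-true {suc n} p zero    | true  = p₀
select-true {suc n} p (suc i) | true  = select-true (p ∘ suc) i
select-true {suc n} p i       | false = select-true (p ∘ suc) i

select-injective : ∀ {n} (p : Fin n → Bool) → Injective _≡_ _≡_ (select p)
select-injective {suc n} p {i} {j} eq with p zero
select-injective {suc n} p {zero}  {zero}  eq | true  = refl
select-injective {suc n} p {suc i} {suc j} eq | true  =
  cong suc (select-injective (p ∘ suc) (Fin.suc-injective eq))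
select-injective {suc n} p {i}     {j}     eq | false =
  select-injective (p ∘ suc) (Fin.suc-injective eq)

δ : ∀ {n} → Fin n → Fin n → ℕ
δ i j = 𝟙 (does (i Fin.≟ j))

sum-δ : ∀ {n} (i : Fin n) (f : Vector ℕ n) → sum (λ j → δ i j * f j) ≡ f i
sum-δ {suc n} zero f = begin
  f zero + 0 + sum {n} (const 0)  ≡⟨ cong₂ _+_ (+-identityʳ (f zero)) (trans (sum-const n 0) (*-zeroʳ n)) ⟩
  f zero + 0                      ≡⟨ +-identityʳ (f zero) ⟩
  f zero                          ∎
  where open ≡-Reasoning
sum-δ (suc i) f = sum-δ i (f ∘ suc)

count-≡ : ∀ {n} (i : Fin n) → count (λ j → does (i Fin.≟ j)) ≡ 1
count-≡ i = trans (sum-cong-≗ (λ j → sym (*-identityʳ (δ i j)))) (sum-δ i (const 1))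

sum-*-sum : ∀ {m n} (f : Vector ℕ m) (g : Vector ℕ n) →
  sum f * sum g ≡ sum (λ i → sum (λ j → f i * g j))
sum-*-sum f g = trans (*-distribʳ-sum (sum g) f) (sum-cong-≗ (λ i → *-distribˡ-sum (f i) g))

2xy≤x²+y² : ∀ x y → x * y + x * y ≤ x * x + y * y
2xy≤x²+y² x y with ≤-total x y
... | inj₁ x≤y with d , refl ← m≤n⇒∃[o]m+o≡n x≤y =
    ≤-trans (m≤m+n _ (d * d)) (≤-reflexive (identity x d))
    where
    identity : ∀ x d → x * (x + d) + x * (x + d) + d * d ≡ x * x + (x + d) * (x + d)
    identity = solve-∀
2xy≤x²+y² x y | inj₂ y≤x with d , refl ← m≤n⇒∃[o]m+o≡n y≤x =
    ≤-trans (m≤m+n _ (d * d)) (≤-reflexive (identity y d))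
    where
    identity : ∀ y d → (y + d) * y + (y + d) * y + d * d ≡ (y + d) * (y + d) + y * y
    identity = solve-∀

-- Twice the expanded square is bounded term by term with `2xy≤x²+y²`, after which each square
-- occurs `2 * r` times.
cauchySchwarz : ∀ {r} (d : Vector ℕ r) → sum d * sum d ≤ r * sum (λ i → d i * d i)
cauchySchwarz {r} d = *-cancelˡ-≤ 2 (begin
  2 * (sum d * sum d)
    ≡⟨ cong (2 *_) (sum-*-sum d d) ⟩
  2 * sum (λ i → sum (λ j → d i * d j))
    ≡⟨ cong (sum (λ i → sum (λ j → d i * d j)) +_) (+-identityʳ _) ⟩
  sum (λ i → sum (λ j → d i * d j)) + sum (λ i → sum (λ j → d i * d j))
    ≡⟨ ∑-distrib-+ (λ i → sum (λ j → d i * d j)) (λ i → sum (λ j → d i * d j)) ⟨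
  sum (λ i → sum (λ j → d i * d j) + sum (λ j → d i * d j))
    ≡⟨ sum-cong-≗ (λ i → ∑-distrib-+ (λ j → d i * d j) (λ j → d i * d j)) ⟨
  sum (λ i → sum (λ j → d i * d j + d i * d j))
    ≤⟨ sum-mono-≤ (λ i → sum-mono-≤ (λ j → 2xy≤x²+y² (d i) (d j))) ⟩
  sum (λ i → sum (λ j → d i * d i + d j * d j))
    ≡⟨ sum-cong-≗ (λ i → trans (∑-distrib-+ (λ _ → d i * d i) (λ j → d j * d j)) (cong (_+ Q) (sum-const r (d i * d i)))) ⟩
  sum (λ i → r * (d i * d i) + Q)
    ≡⟨ ∑-distrib-+ (λ i → r * (d i * d i)) (const Q) ⟩
  sum (λ i → r * (d i * d i)) + sum {r} (const Q)
    ≡⟨ cong₂ _+_ (sym (*-distribˡ-sum r (λ i → d i * d i))) (sum-const r Q) ⟩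
  r * Q + r * Q
    ≡⟨ cong (r * Q +_) (+-identityʳ (r * Q)) ⟨
  2 * (r * Q) ∎)
  where
  open ≤-Reasoning
  Q : ℕ
  Q = sum (λ i → d i * d i)

-- Paths of length 2, upper bound

module _ {n r} (f : Fin n → Fin r) where

  agreements : ℕ
  agreements = sum (λ u → sum (λ v → δ (f u) (f v)))

  private
    fibre : Fin r → ℕ
    fibre i = sum (λ u → δ (f u) i)

    sum-fibre : sum fibre ≡ n
    sum-fibre = begin
      sum (λ i → sum (λ u → δ (f u) i))  ≡⟨ ∑-comm (λ i u → δ (f u) i) ⟩
      sum (λ u → sum (λ i → δ (f u) i))  ≡⟨ sum-cong-≗ (λ u → count-≡ (f u)) ⟩
      sum {n} (const 1)                  ≡⟨ sum-const n 1 ⟩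
      n * 1                              ≡⟨ *-identityʳ n ⟩
      n                                  ∎
      where open ≡-Reasoning

    sum-fibre² : sum (λ i → fibre i * fibre i) ≡ agreements
    sum-fibre² = begin
      sum (λ i → fibre i * fibre i)
        ≡⟨ sum-cong-≗ (λ i → sum-*-sum (λ u → δ (f u) i) (λ v → δ (f v) i)) ⟩
      sum (λ i → sum (λ u → sum (λ v → δ (f u) i * δ (f v) i)))
        ≡⟨ ∑-comm (λ i u → sum (λ v → δ (f u) i * δ (f v) i)) ⟩
      sum (λ u → sum (λ i → sum (λ v → δ (f u) i * δ (f v) i)))
        ≡⟨ sum-cong-≗ (λ u → ∑-comm (λ i v → δ (f u) i * δ (f v) i)) ⟩
      sum (λ u → sum (λ v → sum (λ i → δ (f u) i * δ (f v) i)))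
        ≡⟨ sum-cong-≗ (λ u → sum-cong-≗ (λ v → sum-δ (f u) (λ i → δ (f v) i))) ⟩
      sum (λ u → sum (λ v → δ (f v) (f u)))
        ≡⟨ ∑-comm (λ u v → δ (f v) (f u)) ⟩
      agreements ∎
      where open ≡-Reasoning

  -- Cauchy-Schwarz for the fibre sizes of `f`: they sum to `n`, and their squares sum to the number
  -- of agreeing ordered pairs.
  agreements-bound : n * n ≤ r * agreements
  agreements-bound = begin
    n * n                              ≡⟨ cong₂ _*_ sum-fibre sum-fibre ⟨
    sum fibre * sum fibre              ≤⟨ cauchySchwarz fibre ⟩
    r * sum (λ i → fibre i * fibre i)  ≡⟨ cong (r *_) sum-fibre² ⟩
    r * agreements                     ∎
    where open ≤-Reasoning

differ : ∀ {r} → Fin r → Fin r → Bool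
differ a b = not (does (a Fin.≟ b))

-- The bound (1 - 1/r) n² without division or subtraction; agreeing and differing pairs together
-- make up all n² pairs.
disagreements-bound : ∀ {n r} (f : Fin n → Fin r) →
  r * sum (λ u → count (λ v → differ (f u) (f v))) + n * n ≤ r * (n * n)
disagreements-bound {n} {r} f = begin
  r * Δ + n * n             ≤⟨ +-monoʳ-≤ (r * Δ) (agreements-bound f) ⟩
  r * Δ + r * agreements f  ≡⟨ *-distribˡ-+ r Δ (agreements f) ⟨
  r * (Δ + agreements f)    ≡⟨ cong (r *_) total ⟩
  r * (n * n)               ∎
  where
  open ≤-Reasoning
  Δ : ℕ
  Δ = sum (λ u → count (λ v → differ (f u) (f v)))
  total : Δ + agreements f ≡ n * n
  total = ≡.begin
    Δ + agreements f
      ≡.≡⟨ +-comm Δ (agreements f) ⟩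
    agreements f + Δ
      ≡.≡⟨ ∑-distrib-+ (λ u → sum (λ v → δ (f u) (f v))) (λ u → count (λ v → differ (f u) (f v))) ⟨
    sum (λ u → sum (λ v → δ (f u) (f v)) + count (λ v → differ (f u) (f v)))
      ≡.≡⟨ sum-cong-≗ (λ u → count-not (λ v → does (f u Fin.≟ f v))) ⟩
    sum {n} (const n)
      ≡.≡⟨ sum-const n n ⟩
    n * n ≡.∎
    where module ≡ = ≡-Reasoning

-- Disjoint paths of length 2 have different middle vertices, and alternation says that each middle
-- vertex sees `u` and `v` in different colours.
shortPaths-count : ∀ {r n} (c : Coloring r n) t {u v} → HasDisjointAltPaths c 2 t u v →
  t ≤ count (λ w → differ (col c u w) (col c w v))
shortPaths-count c t {u} {v} (P , path , disjoint) = injective⇒≤count _ middle middle-injective middle-differ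
  where
  middle : Fin t → Fin _
  middle j = P j 1

  middle-injective : Injective _≡_ _≡_ middle
  middle-injective {j} {k} eq with j Fin.≟ k
  ... | yes j≡k = j≡k
  ... | no  j≢k = contradiction eq (disjoint j k j≢k 1 1 ≤-refl ≤-refl ≤-refl ≤-refl)

  middle-differ : ∀ j → differ (col c u (middle j)) (col c (middle j) v) ≡ true
  middle-differ j with isPath , alternating ← path j
    with refl ← IsPath.start isPath | refl ← IsPath.end isPath =
    cong not (dec-false (_ Fin.≟ _) (alternating 0 ≤-refl))

-- Double counting of the triples (u, v, w) in which `w` sees `u` and `v` in different colours, by
-- pairs and by middle vertices. Nothing is known for u = v; the final summand `r` pays for these
-- pairs by means of `t ≤ n`.
shortPaths-bound : ∀ {r n} t → 2 ≤ n → Achievable r 2 n t → r * t + n ≤ r * n + r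
shortPaths-bound {r} {n@(suc _)} t 2≤n (c , achieves) =
  *-cancelʳ-≤ _ _ n (*-cancelʳ-≤ _ _ n (begin
    (r * t + n) * n * n                      ≡⟨ expand r t n ⟩
    r * (n * (n * t)) + n * (n * n)          ≤⟨ +-monoˡ-≤ _ (*-monoʳ-≤ r pairs-≤) ⟩
    r * (T + n * t) + n * (n * n)            ≡⟨ regroup r T (n * t) (n * (n * n)) ⟩
    r * T + n * (n * n) + r * (n * t)        ≤⟨ +-mono-≤ T-≤ (*-monoʳ-≤ r (*-monoʳ-≤ n t≤n)) ⟩
    r * (n * (n * n)) + r * (n * n)          ≡⟨ collect r n ⟩
    (r * n + r) * n * n                      ∎))
  where
  open ≤-Reasoning
  expand : ∀ r t n → (r * t + n) * n * n ≡ r * (n * (n * t)) + n * (n * n)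
  expand = solve-∀
  regroup : ∀ r T x y → r * (T + x) + y ≡ r * T + y + r * x
  regroup = solve-∀
  collect : ∀ r n → r * (n * (n * n)) + r * (n * n) ≡ (r * n + r) * n * n
  collect = solve-∀

  G : Fin n → Fin n → ℕ
  G u v = count (λ w → differ (col c u w) (col c w v))

  T : ℕ
  T = sum (λ u → sum (λ v → G u v))

  t≤n : t ≤ n
  t≤n with u , v , u≢v ← twoVertices 2≤n =
    ≤-trans (≤-reflexive (sym (*-identityʳ t))) (disjointPaths-bound c 1 t (achieves u v u≢v))

  pair-≤ : ∀ u v → t ≤ G u v + δ u v * t
  pair-≤ u v with u Fin.≟ v
  ... | yes _  = ≤-trans (m≤m+n t 0) (m≤n+m (t + 0) (G u v))
  ... | no u≢v = ≤-trans (shortPaths-count c t (achieves u v u≢v)) (m≤m+n (G u v) 0)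

  pairs-≤ : n * (n * t) ≤ T + n * t
  pairs-≤ = begin
    n * (n * t)                                        ≡⟨ sum-const n (n * t) ⟨
    sum {n} (λ _ → n * t)                              ≡⟨ sum-cong-≗ {n} (λ _ → sum-const n t) ⟨
    sum {n} (λ _ → sum {n} (λ _ → t))                  ≤⟨ sum-mono-≤ (λ u → sum-mono-≤ (pair-≤ u)) ⟩
    sum (λ u → sum (λ v → G u v + δ u v * t))          ≡⟨ sum-cong-≗ (λ u → trans (∑-distrib-+ (G u) (λ v → δ u v * t)) (cong (sum (G u) +_) (sum-δ u (const t)))) ⟩
    sum (λ u → sum (G u) + t)                          ≡⟨ ∑-distrib-+ (λ u → sum (G u)) (const t) ⟩
    T + sum {n} (const t)                              ≡⟨ cong (T +_) (sum-const n t) ⟩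
    T + n * t                                          ∎

  by-middle : T ≡ sum (λ w → sum (λ u → count (λ v → differ (col c u w) (col c v w))))
  by-middle = ≡.begin
    T
      ≡.≡⟨ sum-cong-≗ (λ u → ∑-comm (λ v w → 𝟙 (differ (col c u w) (col c w v)))) ⟩
    sum (λ u → sum (λ w → count (λ v → differ (col c u w) (col c w v))))
      ≡.≡⟨ ∑-comm (λ u w → count (λ v → differ (col c u w) (col c w v))) ⟩
    sum (λ w → sum (λ u → count (λ v → differ (col c u w) (col c w v))))
      ≡.≡⟨ sum-cong-≗ (λ w → sum-cong-≗ (λ u → sum-cong-≗ (λ v → cong (𝟙 ∘ differ (col c u w)) (symm c w v)))) ⟩
    sum (λ w → sum (λ u → count (λ v → differ (col c u w) (col c v w)))) ≡.∎
    where module ≡ = ≡-Reasoning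

  T-≤ : r * T + n * (n * n) ≤ r * (n * (n * n))
  T-≤ = begin
    r * T + n * (n * n)
      ≡⟨ cong₂ _+_ (trans (cong (r *_) by-middle) (*-distribˡ-sum r M)) (sym (sum-const n (n * n))) ⟩
    sum (λ w → r * M w) + sum {n} (const (n * n))
      ≡⟨ ∑-distrib-+ (λ w → r * M w) (const (n * n)) ⟨
    sum (λ w → r * M w + n * n)
      ≤⟨ sum-mono-≤ (λ w → disagreements-bound (λ u → col c u w)) ⟩
    sum {n} (const (r * (n * n)))
      ≡⟨ sum-const n (r * (n * n)) ⟩
    n * (r * (n * n))
      ≡⟨ swap n r (n * n) ⟩
    r * (n * (n * n)) ∎
    where
    M : Fin n → ℕ
    M w = sum (λ u → count (λ v → differ (col c u w) (col c v w)))
    swap : ∀ n r x → n * (r * x) ≡ r * (n * x)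
    swap = solve-∀

-- Paths of length 2, lower bound

∃-≤-average : ∀ {r} (f : Vector ℕ (suc r)) B → sum f ≤ suc r * B → ∃[ i ] f i ≤ B
∃-≤-average {r} f B sum≤ with f zero ≤? B
... | yes f₀≤B = zero , f₀≤B
∃-≤-average {zero}  f B sum≤ | no f₀≰B =
  contradiction (≤-trans (m≤m+n (f zero) 0) (≤-trans sum≤ (≤-reflexive (+-identityʳ B)))) f₀≰B
∃-≤-average {suc r} f B sum≤ | no f₀≰B with i , fi≤B ← ∃-≤-average (f ∘ suc) B
  (+-cancelˡ-≤ B _ _ (≤-trans (+-monoˡ-≤ _ (<⇒≤ (≰⇒> f₀≰B))) sum≤)) = suc i , fi≤B

-- Plays the part of independence in an expectation: only the factor at `i` depends on `a`, so the
-- remaining product comes out of the sum.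
product-average : ∀ {n R} (g : Fin R → Vector ℕ n) (h : Vector ℕ n) i →
  (∀ a j → j ≢ i → g a j ≡ h j) → sum (λ a → g a i) ≡ R * h i →
  sum (λ a → product (g a)) ≡ R * product h
product-average {suc n} {R} g h i elsewhere average = begin
  sum (λ a → product (g a))                      ≡⟨ sum-cong-≗ (λ a → product-remove {i = i} (g a)) ⟩
  sum (λ a → g a i * product (removeAt (g a) i)) ≡⟨ sum-cong-≗ (λ a → cong (g a i *_) (product-cong (λ j → elsewhere a _ (punchInᵢ≢i i j)))) ⟩
  sum (λ a → g a i * rest)                       ≡⟨ *-distribʳ-sum rest (λ a → g a i) ⟨
  sum (λ a → g a i) * rest                       ≡⟨ cong (_* rest) average ⟩
  R * h i * rest                                 ≡⟨ *-assoc R (h i) rest ⟩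
  R * (h i * rest)                               ≡⟨ cong (R *_) (product-remove {i = i} h) ⟨
  R * product h                                  ∎
  where
  open ≡-Reasoning
  rest : ℕ
  rest = product (removeAt h i)

module Assignment {V : Set} (_≟_ : DecidableEquality V) {A : Set} where

  _[_≔_] : (V → Maybe A) → V → A → (V → Maybe A)
  (s [ e ≔ a ]) e′ = if does (e ≟ e′) then just a else s e′

  update-≡ : ∀ s e a → (s [ e ≔ a ]) e ≡ just a
  update-≡ s e a rewrite dec-true (e ≟ e) refl = refl

  update-≢ : ∀ s {e e′} a → e′ ≢ e → (s [ e ≔ a ]) e′ ≡ s e′
  update-≢ s {e} {e′} a e′≢e rewrite dec-false (e ≟ e′) (e′≢e ∘ sym) = refl

  -- The method of conditional expectations.
  complete : (Φ : (V → Maybe A) → ℕ) →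
    (∀ s e → s e ≡ nothing → ∃[ a ] Φ (s [ e ≔ a ]) ≤ Φ s) →
    ∀ es s → ∃[ s′ ] (Φ s′ ≤ Φ s × (∀ {e a} → s e ≡ just a → s′ e ≡ just a) ×
                      (∀ {e} → e ∈ es → ∃[ a ] s′ e ≡ just a))
  complete Φ step []       s = s , ≤-refl , (λ se → se) , λ ()
  complete Φ step (e ∷ es) s with s e in se
  ... | just a  with s′ , Φ≤ , keeps , assigns ← complete Φ step es s =
    s′ , Φ≤ , keeps , λ { (here refl) → a , keeps se ; (there e∈es) → assigns e∈es }
  ... | nothing with a , Φa≤ ← step s e se
                with s′ , Φ≤ , keeps , assigns ← complete Φ step es (s [ e ≔ a ]) =
    s′ , ≤-trans Φ≤ Φa≤ , keeps′
       , λ { (here refl) → a , keeps (update-≡ s e a) ; (there e∈es) → assigns e∈es }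
    where
    keeps′ : ∀ {e′ b} → s e′ ≡ just b → s′ e′ ≡ just b
    keeps′ {e′} se′ with e′ ≟ e
    ... | yes refl with () ← trans (sym se) se′
    ... | no e′≢e  = keeps (trans (update-≢ s a e′≢e) se′)

module Edges (n : ℕ) where

  Edge : Set
  Edge = Fin n × Fin n

  _≟ᴱ_ : DecidableEquality Edge
  _≟ᴱ_ = ≡-dec Fin._≟_ Fin._≟_

  -- The unordered pair, with the smaller vertex first, so that both orientations share one colour
  -- variable.
  edge : Fin n → Fin n → Edge
  edge u v with u Fin.≤? v
  ... | yes _ = u , v
  ... | no  _ = v , u

  edge-sym : ∀ u v → edge u v ≡ edge v u
  edge-sym u v with u Fin.≤? v | v Fin.≤? u
  ... | yes u≤v | yes v≤u with refl ← Fin.≤-antisym u≤v v≤u = refl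
  ... | yes _   | no _    = refl
  ... | no _    | yes _   = refl
  ... | no u≰v  | no v≰u  = contradiction (<⇒≤ (≰⇒> u≰v)) v≰u

  edge-split : ∀ u v → edge u v ≡ (u , v) ⊎ edge u v ≡ (v , u)
  edge-split u v with u Fin.≤? v
  ... | yes _ = inj₁ refl
  ... | no  _ = inj₂ refl

  edge-injective : ∀ u v {x y} → edge u v ≡ edge x y → (u ≡ x × v ≡ y) ⊎ (u ≡ y × v ≡ x)
  edge-injective u v {x} {y} eq with edge-split u v | edge-split x y
  ... | inj₁ p | inj₁ q with refl ← trans (sym p) (trans eq q) = inj₁ (refl , refl)
  ... | inj₁ p | inj₂ q with refl ← trans (sym p) (trans eq q) = inj₂ (refl , refl)
  ... | inj₂ p | inj₁ q with refl ← trans (sym p) (trans eq q) = inj₂ (refl , refl)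
  ... | inj₂ p | inj₂ q with refl ← trans (sym p) (trans eq q) = inj₁ (refl , refl)

middle? : ∀ {n} (u v w : Fin n) → Dec (u ≢ w × v ≢ w)
middle? u v w = ¬? (u Fin.≟ w) ×-dec ¬? (v Fin.≟ w)

module _ {r n} (c : Coloring r n) (u v : Fin n) where

  tie : Fin n → Bool
  tie w with middle? u v w
  ... | yes _ = does (col c u w Fin.≟ col c v w)
  ... | no  _ = false

  alternates : Fin n → Bool
  alternates w with middle? u v w
  ... | yes _ = differ (col c u w) (col c w v)
  ... | no  _ = false

  alternates-middle : ∀ w → alternates w ≡ true → (u ≢ w × v ≢ w) × col c u w ≢ col c w v
  alternates-middle w alt with middle? u v w
  ... | yes mid with col c u w Fin.≟ col c w v
  ...   | no ≢ = mid , ≢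

  -- Any `w` other than `u` and `v` is of one of the two kinds by `symm`; the 2 accounts for the
  -- endpoints, where both predicates are false.
  alternates-or-tie : n ≤ count alternates + count tie + 2
  alternates-or-tie = begin
    n
      ≡⟨ trans (sum-const n 1) (*-identityʳ n) ⟨
    sum {n} (const 1)
      ≤⟨ sum-mono-≤ cover ⟩
    sum (λ w → (𝟙 (alternates w) + 𝟙 (tie w)) + (δ u w + δ v w))
      ≡⟨ ∑-distrib-+ (λ w → 𝟙 (alternates w) + 𝟙 (tie w)) (λ w → δ u w + δ v w) ⟩
    sum (λ w → 𝟙 (alternates w) + 𝟙 (tie w)) + sum (λ w → δ u w + δ v w)
      ≡⟨ cong₂ _+_ (∑-distrib-+ (𝟙 ∘ alternates) (𝟙 ∘ tie))
           (trans (∑-distrib-+ (δ u) (δ v)) (cong₂ _+_ (count-≡ u) (count-≡ v))) ⟩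
    count alternates + count tie + 2 ∎
    where
    open ≤-Reasoning
    cover : ∀ w → 1 ≤ (𝟙 (alternates w) + 𝟙 (tie w)) + (δ u w + δ v w)
    cover w with middle? u v w
    ... | yes _ rewrite symm c w v = ≤-trans
      (≤-reflexive (trans (sym (𝟙-not same)) (+-comm (𝟙 same) (𝟙 (not same)))))
      (m≤m+n _ (δ u w + δ v w))
      where
      same : Bool
      same = does (col c u w Fin.≟ col c v w)
    ... | no ¬mid with u Fin.≟ w | v Fin.≟ w
    ...   | yes _  | _      = s≤s z≤n
    ...   | no _   | yes _  = s≤s z≤n
    ...   | no u≢w | no v≢w = contradiction (u≢w , v≢w) ¬mid

  shortPaths : ∀ {t} → u ≢ v → t ≤ count alternates → HasDisjointAltPaths c 2 t u v
  shortPaths {t} u≢v t≤ = through , (λ j → isPath j , alternating j) , disjoint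
    where
    w : Fin t → Fin n
    w j = select alternates (inject≤ j t≤)

    w-middle : ∀ j → (u ≢ w j × v ≢ w j) × col c u (w j) ≢ col c (w j) v
    w-middle j = alternates-middle (w j) (select-true alternates _)

    through : Fin t → ℕ → Fin n
    through j = Through.through u v (λ (_ : Fin 1) → w j)

    isPath : ∀ j → IsPath n 2 u v (through j)
    isPath j = Through.through-isPath u v (λ _ → w j) u≢v (λ { {zero} {zero} _ → refl })
      (λ _ → proj₁ (proj₁ (w-middle j))) (λ _ → proj₂ (proj₁ (w-middle j)) ∘ sym)

    alternating : ∀ j → Alternating c 2 (through j)
    alternating j zero    _                 = proj₂ (w-middle j)
    alternating j (suc i) i+3≤2 = contradiction (≤-trans i+3≤2 (m≤n+m 2 i)) 1+n≰n

    disjoint : ∀ j k → j ≢ k → ∀ a b → 1 ≤ a → a + 1 ≤ 2 → 1 ≤ b → b + 1 ≤ 2 → through j a ≢ through k b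
    disjoint j k j≢k 1 1 _ _ _ _ eq =
      j≢k (inject≤-injective t≤ t≤ j k (select-injective alternates eq))
    disjoint j k _ 1 (suc (suc b)) _ _ _ (s≤s (s≤s b+1≤0)) _ with () ← ≤-trans (m≤n+m 1 b) b+1≤0
    disjoint j k _ (suc (suc a)) _ _ (s≤s (s≤s a+1≤0)) _ _ _ with () ← ≤-trans (m≤n+m 1 a) a+1≤0

module Potential (n r k : ℕ) where
  open Edges n
  open Assignment _≟ᴱ_ {Fin (suc r)}

  State : Set
  State = Edge → Maybe (Fin (suc r))

  -- Once one of the two colours is known, the average weight over the other one is 1 + k.
  weight : Maybe (Fin (suc r)) → Maybe (Fin (suc r)) → ℕ
  weight (just a) (just b) = if does (a Fin.≟ b) then suc r + k else k
  weight (just _) nothing  = suc k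
  weight nothing  _        = suc k

  weight-nothingʳ : ∀ x → weight x nothing ≡ suc k
  weight-nothingʳ (just _) = refl
  weight-nothingʳ nothing  = refl

  weight-sym : ∀ x y → weight x y ≡ weight y x
  weight-sym (just a) (just b) with a Fin.≟ b | b Fin.≟ a
  ... | yes _   | yes _   = refl
  ... | no _    | no _    = refl
  ... | yes a≡b | no b≢a  = contradiction (sym a≡b) b≢a
  ... | no a≢b  | yes b≡a = contradiction (sym b≡a) a≢b
  weight-sym (just _) nothing  = refl
  weight-sym nothing  (just _) = refl
  weight-sym nothing  nothing  = refl

  -- If `y` is a known colour, exactly one of the `suc r` choices matches it, which raises the total
  -- `suc r * k` by `suc r`.
  weight-average : ∀ y → sum (λ a → weight (just a) y) ≡ suc r * suc k
  weight-average nothing  = sum-const (suc r) (suc k)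
  weight-average (just b) = begin
    sum (λ a → weight (just a) (just b))               ≡⟨ sum-cong-≗ (λ a → trans (weight-sym (just a) (just b)) (split a)) ⟩
    sum (λ a → δ b a * suc r + k)                      ≡⟨ ∑-distrib-+ (λ a → δ b a * suc r) (const k) ⟩
    sum (λ a → δ b a * suc r) + sum {suc r} (const k)  ≡⟨ cong₂ _+_ (sum-δ b (const (suc r))) (sum-const (suc r) k) ⟩
    suc r + suc r * k                                  ≡⟨ *-suc (suc r) k ⟨
    suc r * suc k                                      ∎
    where
    open ≡-Reasoning
    split : ∀ a → weight (just b) (just a) ≡ δ b a * suc r + k
    split a with does (b Fin.≟ a)
    ... | true  = cong (_+ k) (sym (+-identityʳ (suc r)))
    ... | false = refl

  -- At the endpoints the factor is the constant `suc k` of an undecided vertex. It does not depend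
  -- on the state, and it is at least the weight `k` of a non-tie.
  factor : State → Fin n → Fin n → Fin n → ℕ
  factor s u v w with middle? u v w
  ... | yes _ = weight (s (edge u w)) (s (edge v w))
  ... | no  _ = suc k

  factor-middle : ∀ s {u v w} → u ≢ w × v ≢ w → factor s u v w ≡ weight (s (edge u w)) (s (edge v w))
  factor-middle s {u} {v} {w} mid with middle? u v w
  ... | yes _   = refl
  ... | no ¬mid = contradiction mid ¬mid

  factor-cong : ∀ s s′ u v w →
    (u ≢ w × v ≢ w → s (edge u w) ≡ s′ (edge u w) × s (edge v w) ≡ s′ (edge v w)) →
    factor s u v w ≡ factor s′ u v w
  factor-cong s s′ u v w agree with middle? u v w
  ... | yes mid = cong₂ weight (proj₁ (agree mid)) (proj₂ (agree mid))
  ... | no  _   = refl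

  touches? : (e : Edge) (u v : Fin n) → Dec (∃[ w ] ((u ≢ w × v ≢ w) × (edge u w ≡ e ⊎ edge v w ≡ e)))
  touches? e u v = any? (λ w → middle? u v w ×-dec ((edge u w ≟ᴱ e) ⊎-dec (edge v w ≟ᴱ e)))

  edge-otherEnd : ∀ {u w w′} → u ≢ w → edge u w′ ≡ edge u w → w ≡ w′
  edge-otherEnd {u} {w} {w′} u≢w eq with edge-injective u w′ eq
  ... | inj₁ (_ , w′≡w) = sym w′≡w
  ... | inj₂ (u≡w , _)  = contradiction u≡w u≢w

  edge-apart : ∀ {u v w w′} → u ≢ v → u ≢ w′ → edge v w′ ≢ edge u w
  edge-apart {v = v} {w′ = w′} u≢v u≢w′ eq with edge-injective v w′ eq
  ... | inj₁ (v≡u , _)  = u≢v (sym v≡u)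
  ... | inj₂ (_ , w′≡u) = u≢w′ (sym w′≡u)

  -- Such an edge contains exactly one of `u` and `v`, and its other end is the middle vertex. Hence
  -- colouring one edge alters at most one factor of a pair.
  touch-unique : ∀ {e u v w w′} → u ≢ v → u ≢ w × v ≢ w → u ≢ w′ × v ≢ w′ →
    edge u w ≡ e ⊎ edge v w ≡ e → edge u w′ ≡ e ⊎ edge v w′ ≡ e → w ≡ w′
  touch-unique u≢v (u≢w , _) _ (inj₁ refl) (inj₁ eq) = edge-otherEnd u≢w eq
  touch-unique u≢v (_ , v≢w) _ (inj₂ refl) (inj₂ eq) = edge-otherEnd v≢w eq
  touch-unique u≢v _ (u≢w′ , _) (inj₁ refl) (inj₂ eq) = contradiction eq (edge-apart u≢v u≢w′)
  touch-unique u≢v _ (_ , v≢w′) (inj₂ refl) (inj₁ eq) = contradiction eq (edge-apart (u≢v ∘ sym) v≢w′)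

  pairProduct : State → Fin n → Fin n → ℕ
  pairProduct s u v = product (factor s u v)

  -- The product of an untouched pair is constant. Otherwise a single factor varies, through only
  -- one of its two edges, and by `weight-average` its mean is `suc k`, the value it had before.
  pairProduct-average : ∀ s e → s e ≡ nothing → ∀ {u v} → u ≢ v →
    sum (λ a → pairProduct (s [ e ≔ a ]) u v) ≡ suc r * pairProduct s u v
  pairProduct-average s e se {u} {v} u≢v with touches? e u v
  ... | no untouched = trans
    (sum-cong-≗ (λ a → product-cong (λ w → factor-cong (s [ e ≔ a ]) s u v w (λ mid →
      update-≢ s a (λ eq → untouched (w , mid , inj₁ eq)) ,
      update-≢ s a (λ eq → untouched (w , mid , inj₂ eq))))))
    (sum-const (suc r) (pairProduct s u v))
  ... | yes (w , mid , touch) =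
    product-average (λ a → factor (s [ e ≔ a ]) u v) (factor s u v) w
      (λ a w′ w′≢w → factor-cong (s [ e ≔ a ]) s u v w′ (λ mid′ →
        update-≢ s a (λ eq → w′≢w (touch-unique u≢v mid′ mid (inj₁ eq) touch)) ,
        update-≢ s a (λ eq → w′≢w (touch-unique u≢v mid′ mid (inj₂ eq) touch))))
      (average touch)
    where
    open ≡-Reasoning
    u≢w = proj₁ mid
    edges≢ : edge u w ≢ edge v w
    edges≢ eq with edge-injective u w eq
    ... | inj₁ (u≡v , _) = u≢v u≡v
    ... | inj₂ (u≡w , _) = u≢w u≡w
    average : edge u w ≡ e ⊎ edge v w ≡ e →
      sum (λ a → factor (s [ e ≔ a ]) u v w) ≡ suc r * factor s u v w
    average (inj₁ refl) = begin
      sum (λ a → factor (s [ e ≔ a ]) u v w)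
        ≡⟨ sum-cong-≗ (λ a → trans (factor-middle (s [ e ≔ a ]) mid)
             (cong₂ weight (update-≡ s e a) (update-≢ s a (edges≢ ∘ sym)))) ⟩
      sum (λ a → weight (just a) (s (edge v w)))
        ≡⟨ weight-average (s (edge v w)) ⟩
      suc r * suc k
        ≡⟨ cong (λ x → suc r * weight x (s (edge v w))) se ⟨
      suc r * weight (s (edge u w)) (s (edge v w))
        ≡⟨ cong (suc r *_) (factor-middle s mid) ⟨
      suc r * factor s u v w ∎
    average (inj₂ refl) = begin
      sum (λ a → factor (s [ e ≔ a ]) u v w)
        ≡⟨ sum-cong-≗ (λ a → trans (factor-middle (s [ e ≔ a ]) mid) (trans
             (cong₂ weight (update-≢ s a edges≢) (update-≡ s e a)) (weight-sym (s (edge u w)) (just a)))) ⟩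
      sum (λ a → weight (just a) (s (edge u w)))
        ≡⟨ weight-average (s (edge u w)) ⟩
      suc r * suc k
        ≡⟨ cong (suc r *_) (trans (cong (weight (s (edge u w))) se) (weight-nothingʳ (s (edge u w)))) ⟨
      suc r * weight (s (edge u w)) (s (edge v w))
        ≡⟨ cong (suc r *_) (factor-middle s mid) ⟨
      suc r * factor s u v w ∎

  -- The diagonal is left out: there both edges to `w` coincide, and the average need not be
  -- preserved.
  pairPotential : State → Fin n → Fin n → ℕ
  pairPotential s u v = if does (u Fin.≟ v) then 0 else pairProduct s u v

  pairPotential-average : ∀ s e → s e ≡ nothing → ∀ u v →
    sum (λ a → pairPotential (s [ e ≔ a ]) u v) ≡ suc r * pairPotential s u v
  pairPotential-average s e se u v with u Fin.≟ v
  ... | yes _  = sum-const (suc r) 0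
  ... | no u≢v = pairProduct-average s e se u≢v

  Φ : State → ℕ
  Φ s = sum (λ u → sum (λ v → pairPotential s u v))

  Φ-average : ∀ s e → s e ≡ nothing → sum (λ a → Φ (s [ e ≔ a ])) ≡ suc r * Φ s
  Φ-average s e se = begin
    sum (λ a → sum (λ u → sum (λ v → F a u v)))  ≡⟨ ∑-comm (λ a u → sum (λ v → F a u v)) ⟩
    sum (λ u → sum (λ a → sum (λ v → F a u v)))  ≡⟨ sum-cong-≗ (λ u → ∑-comm (λ a v → F a u v)) ⟩
    sum (λ u → sum (λ v → sum (λ a → F a u v)))  ≡⟨ sum-cong-≗ (λ u → sum-cong-≗ (λ v → pairPotential-average s e se u v)) ⟩
    sum (λ u → sum (λ v → suc r * pairPotential s u v))  ≡⟨ sum-cong-≗ (λ u → *-distribˡ-sum (suc r) (pairPotential s u)) ⟨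
    sum (λ u → suc r * sum (pairPotential s u))  ≡⟨ *-distribˡ-sum (suc r) (λ u → sum (pairPotential s u)) ⟨
    suc r * Φ s ∎
    where
    open ≡-Reasoning
    F : Fin (suc r) → Fin n → Fin n → ℕ
    F a u v = pairPotential (s [ e ≔ a ]) u v

  empty : State
  empty _ = nothing

  Φ-empty : Φ empty ≤ n * (n * suc k ^ n)
  Φ-empty = begin
    Φ empty                                        ≤⟨ sum-mono-≤ (λ u → sum-mono-≤ (λ v → bound u v)) ⟩
    sum {n} (λ _ → sum {n} (const (suc k ^ n)))    ≡⟨ sum-cong-≗ {n} (λ _ → sum-const n (suc k ^ n)) ⟩
    sum {n} (const (n * suc k ^ n))                ≡⟨ sum-const n (n * suc k ^ n) ⟩
    n * (n * suc k ^ n)                            ∎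
    where
    open ≤-Reasoning
    factor-empty : ∀ u v w → factor empty u v w ≡ suc k
    factor-empty u v w with middle? u v w
    ... | yes _ = refl
    ... | no  _ = refl
    bound : ∀ u v → pairPotential empty u v ≤ suc k ^ n
    bound u v with does (u Fin.≟ v)
    ... | true  = z≤n
    ... | false = ≤-reflexive (trans (product-cong (factor-empty u v)) (product-const n (suc k)))

  private
    completion = complete Φ (λ s e se → ∃-≤-average (λ a → Φ (s [ e ≔ a ])) (Φ s) (≤-reflexive (Φ-average s e se)))
      (cartesianProduct (allFin n) (allFin n)) empty

  final : State
  final = proj₁ completion

  final-just : ∀ e → ∃[ a ] final e ≡ just a
  final-just (u , v) = proj₂ (proj₂ (proj₂ completion)) (∈-cartesianProduct⁺ (∈-allFin u) (∈-allFin v))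

  Φ-final : Φ final ≤ n * (n * suc k ^ n)
  Φ-final = ≤-trans (proj₁ (proj₂ completion)) Φ-empty

  coloring : Coloring (suc r) n
  coloring = record
    { col  = λ u v → proj₁ (final-just (edge u v))
    ; symm = λ u v → cong (proj₁ ∘ final-just) (edge-sym u v)
    }

  -- In the final state every edge has a colour, so the left side is at most the product of the
  -- pair. That product is one summand of `Φ`, which has not risen above its initial value.
  ties-bound : ∀ {u v} → u ≢ v →
    (suc r + k) ^ count (tie coloring u v) * k ^ count (not ∘ tie coloring u v) ≤ n * (n * suc k ^ n)
  ties-bound {u} {v} u≢v = begin
    (suc r + k) ^ count (tie coloring u v) * k ^ count (not ∘ tie coloring u v)  ≡⟨ product-if (tie coloring u v) (suc r + k) k ⟨
    product (λ w → if tie coloring u v w then suc r + k else k)         ≤⟨ product-mono-≤ tie-≤ ⟩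
    pairProduct final u v                                      ≡⟨ cong (λ b → if b then 0 else pairProduct final u v) (dec-false (u Fin.≟ v) u≢v) ⟨
    pairPotential final u v                                    ≤⟨ ≤-sum (pairPotential final u) v ⟩
    sum (pairPotential final u)                                ≤⟨ ≤-sum (λ u → sum (pairPotential final u)) u ⟩
    Φ final                                                    ≤⟨ Φ-final ⟩
    n * (n * suc k ^ n)                                        ∎
    where
    open ≤-Reasoning
    tie-≤ : ∀ w → (if tie coloring u v w then suc r + k else k) ≤ factor final u v w
    tie-≤ w with middle? u v w
    ... | no  _ = n≤1+n k
    ... | yes _ = ≤-reflexive (sym (cong₂ weight (proj₂ (final-just (edge u w))) (proj₂ (final-just (edge v w)))))

-- Exponential estimates

^-distribʳ-* : ∀ m n o → (m * n) ^ o ≡ m ^ o * n ^ o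
^-distribʳ-* m n zero    = refl
^-distribʳ-* m n (suc o) = trans (cong (m * n *_) (^-distribʳ-* m n o)) (exchange m n (m ^ o) (n ^ o))
  where
  exchange : ∀ a b c d → a * b * (c * d) ≡ a * c * (b * d)
  exchange = solve-∀

-- Bernoulli's inequality (1 + R/k)^Q ≥ 1 + RQ/k, cleared of denominators.
bernoulli : ∀ R k Q → k ^ Q * (k + R * Q) ≤ (R + k) ^ Q * k
bernoulli R k zero    = ≤-reflexive (cong (1 *_) (trans (cong (k +_) (*-zeroʳ R)) (+-identityʳ k)))
bernoulli R k (suc Q) = begin
  k * k ^ Q * (k + R * suc Q)                     ≤⟨ m≤m+n _ _ ⟩
  k * k ^ Q * (k + R * suc Q) + k ^ Q * (R * R * Q) ≡⟨ expand R k Q (k ^ Q) ⟩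
  (R + k) * (k ^ Q * (k + R * Q))                 ≤⟨ *-monoʳ-≤ (R + k) (bernoulli R k Q) ⟩
  (R + k) * ((R + k) ^ Q * k)                     ≡⟨ *-assoc (R + k) ((R + k) ^ Q) k ⟨
  (R + k) * (R + k) ^ Q * k                       ∎
  where
  open ≤-Reasoning
  expand : ∀ R k Q p → k * p * (k + R * (1 + Q)) + p * (R * R * Q) ≡ (R + k) * (p * (k + R * Q))
  expand = solve-∀

-- This is (1 + 1/k)^j ≤ 1 + j/k + j²/k². The quadratic term makes the induction close: the new
-- summand `j * j` is absorbed by `suc j * k`.
[1+1/k]^j-quadratic : ∀ k j → j * j ≤ k → (1 + k) ^ j * (k * k) ≤ k ^ j * (k * k + j * k + j * j)
[1+1/k]^j-quadratic k zero    _ = ≤-reflexive (cong (1 *_) (sym (trans (+-identityʳ _) (+-identityʳ _))))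
[1+1/k]^j-quadratic k (suc j) [1+j]²≤k = begin
  (1 + k) * (1 + k) ^ j * (k * k)
    ≡⟨ *-assoc (1 + k) ((1 + k) ^ j) (k * k) ⟩
  (1 + k) * ((1 + k) ^ j * (k * k))
    ≤⟨ *-monoʳ-≤ (1 + k) ([1+1/k]^j-quadratic k j j²≤k) ⟩
  (1 + k) * (k ^ j * (k * k + j * k + j * j))
    ≡⟨ expand k j (k ^ j) ⟩
  k ^ j * (k * (k * k + j * k + j * j) + (k * k + j * k) + j * j)
    ≤⟨ *-monoʳ-≤ (k ^ j) (+-monoʳ-≤ _ (≤-trans j²≤k (m≤n*m k (suc j)))) ⟩
  k ^ j * (k * (k * k + j * k + j * j) + (k * k + j * k) + suc j * k)
    ≡⟨ collect k j (k ^ j) ⟩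
  k * k ^ j * (k * k + suc j * k + suc j * suc j) ∎
  where
  open ≤-Reasoning
  j²≤k : j * j ≤ k
  j²≤k = ≤-trans (*-mono-≤ (n≤1+n j) (n≤1+n j)) [1+j]²≤k
  expand : ∀ k j p → (1 + k) * (p * (k * k + j * k + j * j)) ≡ p * (k * (k * k + j * k + j * j) + (k * k + j * k) + j * j)
  expand = solve-∀
  collect : ∀ k j p → p * (k * (k * k + j * k + j * j) + (k * k + j * k) + (1 + j) * k) ≡ k * p * (k * k + (1 + j) * k + (1 + j) * (1 + j))
  collect = solve-∀

-- Since a² ≤ k, the quadratic term a²/k² is at most 1/k, which turns a/k into (a + 1)/k.
[1+1/k]^a≤ : ∀ k a .{{_ : NonZero k}} → a * a ≤ k → (1 + k) ^ a * k ≤ k ^ a * (k + suc a)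
[1+1/k]^a≤ k a a²≤k = *-cancelʳ-≤ _ _ k (begin
  (1 + k) ^ a * k * k               ≡⟨ *-assoc ((1 + k) ^ a) k k ⟩
  (1 + k) ^ a * (k * k)             ≤⟨ [1+1/k]^j-quadratic k a a²≤k ⟩
  k ^ a * (k * k + a * k + a * a)   ≤⟨ *-monoʳ-≤ (k ^ a) (+-monoʳ-≤ (k * k + a * k) a²≤k) ⟩
  k ^ a * (k * k + a * k + k)       ≡⟨ collect k a (k ^ a) ⟩
  k ^ a * (k + suc a) * k           ∎)
  where
  open ≤-Reasoning
  collect : ∀ k a p → p * (k * k + a * k + k) ≡ p * (k + (1 + a)) * k
  collect = solve-∀

-- (1 + 1/k) ^ (R Q - 1) ≤ (1 + R/k) ^ Q for large k, cleared of denominators.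
compare-bases : ∀ R Q k a .{{_ : NonZero k}} → suc a ≡ R * Q → a * a ≤ k →
  (1 + k) ^ a * k ^ Q ≤ k ^ a * (R + k) ^ Q
compare-bases R Q k a 1+a≡RQ a²≤k = *-cancelʳ-≤ _ _ k (begin
  (1 + k) ^ a * k ^ Q * k         ≡⟨ swap ((1 + k) ^ a) (k ^ Q) k ⟩
  (1 + k) ^ a * k * k ^ Q         ≤⟨ *-monoˡ-≤ (k ^ Q) ([1+1/k]^a≤ k a a²≤k) ⟩
  k ^ a * (k + suc a) * k ^ Q     ≡⟨ cong (λ x → k ^ a * (k + x) * k ^ Q) 1+a≡RQ ⟩
  k ^ a * (k + R * Q) * k ^ Q     ≡⟨ regroup (k ^ a) (k + R * Q) (k ^ Q) ⟩
  k ^ a * (k ^ Q * (k + R * Q))   ≤⟨ *-monoʳ-≤ (k ^ a) (bernoulli R k Q) ⟩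
  k ^ a * ((R + k) ^ Q * k)       ≡⟨ *-assoc (k ^ a) ((R + k) ^ Q) k ⟨
  k ^ a * (R + k) ^ Q * k         ∎)
  where
  open ≤-Reasoning
  swap : ∀ x y z → x * y * z ≡ x * z * y
  swap = solve-∀
  regroup : ∀ x y z → x * y * z ≡ x * (z * y)
  regroup = solve-∀

dyadic : ∀ n .{{_ : NonZero n}} → ∃[ h ] 2 ^ h ≤ n × n < 2 ^ suc h
dyadic 1 = 0 , s≤s z≤n , s≤s (s≤s z≤n)
dyadic (suc n@(suc _)) with h , 2^h≤n , n<2^[1+h] ← dyadic n with m≤n⇒m<n∨m≡n n<2^[1+h]
... | inj₁ 1+n<2^[1+h] = h , m≤n⇒m≤1+n 2^h≤n , 1+n<2^[1+h]
... | inj₂ 1+n≡2^[1+h] = suc h , ≤-reflexive (sym 1+n≡2^[1+h])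
    , subst (_< 2 ^ suc (suc h)) (sym 1+n≡2^[1+h]) (^-monoʳ-< 2 (s≤s (s≤s z≤n)) (n<1+n (suc h)))

n<2^n : ∀ n → n < 2 ^ n
n<2^n zero    = s≤s z≤n
n<2^n (suc n) = ≤-trans (+-mono-≤ {1} (m^n>0 2 n) (n<2^n n)) (≤-reflexive (cong (2 ^ n +_) (sym (+-identityʳ (2 ^ n)))))

-- With h = M + y and M² ≤ y, the left side is at most (1 + M)(1 + y), and these factors are at most
-- 2^M and 2^y.
linear≤2^ : ∀ M h → M + M * M ≤ h → M * suc h ≤ 2 ^ h
linear≤2^ M h M+M²≤h with y , refl ← m≤n⇒∃[o]m+o≡n (≤-trans (m≤m+n M (M * M)) M+M²≤h) = begin
  M * suc (M + y)           ≡⟨ expand M y ⟩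
  M * M + (M * y + M)       ≤⟨ +-monoˡ-≤ (M * y + M) (≤-trans (+-cancelˡ-≤ M _ _ M+M²≤h) (n≤1+n y)) ⟩
  suc y + (M * y + M)       ≡⟨ collect M y ⟩
  suc M * suc y             ≤⟨ *-mono-≤ (n<2^n M) (n<2^n y) ⟩
  2 ^ M * 2 ^ y             ≡⟨ ^-distribˡ-+-* 2 M y ⟨
  2 ^ (M + y)               ∎
  where
  open ≤-Reasoning
  expand : ∀ M y → M * (1 + (M + y)) ≡ M * M + (M * y + M)
  expand = solve-∀
  collect : ∀ M y → 1 + y + (M * y + M) ≡ (1 + M) * (1 + y)
  collect = solve-∀

-- Bernoulli with exponent `k` gives (1 + R/k)^k ≥ 1 + R ≥ 2.
doubling : ∀ R k .{{_ : NonZero R}} .{{_ : NonZero k}} → 2 * k ^ k ≤ (R + k) ^ k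
doubling R k = *-cancelʳ-≤ _ _ k (begin
  2 * k ^ k * k          ≡⟨ regroup k (k ^ k) ⟩
  k ^ k * (k + k)        ≤⟨ *-monoʳ-≤ (k ^ k) (+-monoʳ-≤ k (m≤n*m k R)) ⟩
  k ^ k * (k + R * k)    ≤⟨ bernoulli R k k ⟩
  (R + k) ^ k * k        ∎)
  where
  open ≤-Reasoning
  regroup : ∀ k p → 2 * p * k ≡ p * (k + k)
  regroup = solve-∀

doubling-^ : ∀ R k E n .{{_ : NonZero R}} .{{_ : NonZero k}} → k * E ≤ n → 2 ^ E * k ^ n ≤ (R + k) ^ n
doubling-^ R k E n kE≤n with y , refl ← m≤n⇒∃[o]m+o≡n kE≤n = begin
  2 ^ E * k ^ (k * E + y)          ≡⟨ cong (2 ^ E *_) (^-distribˡ-+-* k (k * E) y) ⟩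
  2 ^ E * (k ^ (k * E) * k ^ y)    ≡⟨ *-assoc (2 ^ E) (k ^ (k * E)) (k ^ y) ⟨
  2 ^ E * k ^ (k * E) * k ^ y      ≡⟨ cong (λ x → 2 ^ E * x * k ^ y) (^-*-assoc k k E) ⟨
  2 ^ E * (k ^ k) ^ E * k ^ y      ≡⟨ cong (_* k ^ y) (^-distribʳ-* 2 (k ^ k) E) ⟨
  (2 * k ^ k) ^ E * k ^ y          ≤⟨ *-mono-≤ (^-monoˡ-≤ E (doubling R k)) (^-monoˡ-≤ y (m≤n+m k R)) ⟩
  ((R + k) ^ k) ^ E * (R + k) ^ y  ≡⟨ cong (_* (R + k) ^ y) (^-*-assoc (R + k) k E) ⟩
  (R + k) ^ (k * E) * (R + k) ^ y  ≡⟨ ^-distribˡ-+-* (R + k) (k * E) y ⟨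
  (R + k) ^ (k * E + y)            ∎
  where open ≤-Reasoning

-- If 2^h ≤ n < 2^(h+1), then n^C is at most 2^((h+1)C), while (1 + R/k)^n doubles at least
-- (h+1)(C+1) times, each doubling costing `k` of the exponent. The threshold forces
-- `M + M * M ≤ h`, so `linear≤2^` provides room for all these doublings.
exponential-beats-power : ∀ R k C .{{_ : NonZero R}} .{{_ : NonZero k}} →
  ∃[ N ] ∀ n → N ≤ n → n ^ C * k ^ n < (R + k) ^ n
exponential-beats-power R k C = 2 ^ (M + M * M) , beats
  where
  M : ℕ
  M = k * suc C

  beats : ∀ n → 2 ^ (M + M * M) ≤ n → n ^ C * k ^ n < (R + k) ^ n
  beats n N≤n = go {{>-nonZero (≤-trans (m^n>0 2 (M + M * M)) N≤n)}}
    where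
    open ≤-Reasoning
    go : .{{NonZero n}} → n ^ C * k ^ n < (R + k) ^ n
    go with h , 2^h≤n , n<2^[1+h] ← dyadic n = begin-strict
      n ^ C * k ^ n                 ≤⟨ *-monoˡ-≤ (k ^ n) (^-monoˡ-≤ C (<⇒≤ n<2^[1+h])) ⟩
      (2 ^ suc h) ^ C * k ^ n       ≡⟨ cong (_* k ^ n) (^-*-assoc 2 (suc h) C) ⟩
      2 ^ (suc h * C) * k ^ n       <⟨ *-monoˡ-< (k ^ n) {{m^n≢0 k n}} (^-monoʳ-< 2 (s≤s (s≤s z≤n)) exponent<) ⟩
      2 ^ (suc h * suc C) * k ^ n   ≤⟨ doubling-^ R k (suc h * suc C) n exponent≤ ⟩
      (R + k) ^ n                   ∎
      where
      exponent< : suc h * C < suc h * suc C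
      exponent< = *-monoʳ-< (suc h) (n<1+n C)
      M+M²≤h : M + M * M ≤ h
      M+M²≤h with M + M * M ≤? h
      ... | yes p = p
      ... | no ¬p = contradiction (≤-trans (^-monoʳ-≤ 2 (≰⇒> ¬p)) N≤n) (<⇒≱ n<2^[1+h])
      exponent≤ : k * (suc h * suc C) ≤ n
      exponent≤ = begin
        k * (suc h * suc C)  ≡⟨ regroup k (suc h) (suc C) ⟩
        M * suc h            ≤⟨ linear≤2^ M h M+M²≤h ⟩
        2 ^ h                ≤⟨ 2^h≤n ⟩
        n                    ∎
        where
        regroup : ∀ x y z → x * (y * z) ≡ x * z * y
        regroup = solve-∀

-- With X = R + k this bounds S by about n / R.
exponent-bound : ∀ R Q a k n S S′ .{{_ : NonZero R}} .{{_ : NonZero k}} →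
  suc a ≡ R * Q → a * a ≤ k → S + S′ ≡ n →
  n ^ (2 * a) * k ^ n < (R + k) ^ n →
  (R + k) ^ S * k ^ S′ ≤ n * (n * (1 + k) ^ n) →
  S * a ≤ suc Q * n
exponent-bound R Q a k n S S′ 1+a≡RQ a²≤k S+S′≡n large bound with ≤-total (S * a) (suc Q * n)
... | inj₁ Sa≤ = Sa≤
-- With x = X/k and y = Y/k, the hypotheses say x^S ≤ n² y^n and y^a ≤ x^Q, hence x^(Sa) ≤ n^(2a)
-- x^(Qn). If Sa ≥ (Q+1)n, this leaves x^n ≤ n^(2a), against `large`.
... | inj₂ ≤Sa with e , eq ← m≤n⇒∃[o]m+o≡n ≤Sa = contradiction X^n≤ (<⇒≱ large)
  where
  open ≤-Reasoning
  X Y B : ℕ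
  X = R + k
  Y = 1 + k
  B = n ^ (2 * a)

  instance
    X≢0 : NonZero X
    X≢0 = >-nonZero (≤-trans (>-nonZero⁻¹ k) (m≤n+m k R))

  n²^a : (n * n) ^ a ≡ B
  n²^a = trans (cong (_^ a) (sym (cong (n *_) (*-identityʳ n)))) (^-*-assoc n 2 a)

  powered : X ^ (S * a) * k ^ (S′ * a) ≤ B * Y ^ (n * a)
  powered = begin
    X ^ (S * a) * k ^ (S′ * a)        ≡⟨ cong₂ _*_ (^-*-assoc X S a) (^-*-assoc k S′ a) ⟨
    (X ^ S) ^ a * (k ^ S′) ^ a        ≡⟨ ^-distribʳ-* (X ^ S) (k ^ S′) a ⟨
    (X ^ S * k ^ S′) ^ a              ≤⟨ ^-monoˡ-≤ a bound ⟩
    (n * (n * Y ^ n)) ^ a             ≡⟨ cong (_^ a) (*-assoc n n (Y ^ n)) ⟨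
    (n * n * Y ^ n) ^ a               ≡⟨ ^-distribʳ-* (n * n) (Y ^ n) a ⟩
    (n * n) ^ a * (Y ^ n) ^ a         ≡⟨ cong₂ _*_ n²^a (^-*-assoc Y n a) ⟩
    B * Y ^ (n * a)                   ∎

  bases : Y ^ (n * a) * k ^ (Q * n) ≤ k ^ (S * a) * k ^ (S′ * a) * X ^ (Q * n)
  bases = begin
    Y ^ (n * a) * k ^ (Q * n)                       ≡⟨ cong (λ x → Y ^ x * k ^ (Q * n)) (*-comm n a) ⟩
    Y ^ (a * n) * k ^ (Q * n)                       ≡⟨ cong₂ _*_ (^-*-assoc Y a n) (^-*-assoc k Q n) ⟨
    (Y ^ a) ^ n * (k ^ Q) ^ n                       ≡⟨ ^-distribʳ-* (Y ^ a) (k ^ Q) n ⟨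
    (Y ^ a * k ^ Q) ^ n                             ≤⟨ ^-monoˡ-≤ n (compare-bases R Q k a 1+a≡RQ a²≤k) ⟩
    (k ^ a * X ^ Q) ^ n                             ≡⟨ ^-distribʳ-* (k ^ a) (X ^ Q) n ⟩
    (k ^ a) ^ n * (X ^ Q) ^ n                       ≡⟨ cong₂ _*_ (^-*-assoc k a n) (^-*-assoc X Q n) ⟩
    k ^ (a * n) * X ^ (Q * n)                       ≡⟨ cong (λ x → k ^ x * X ^ (Q * n)) a*n≡ ⟩
    k ^ (S * a + S′ * a) * X ^ (Q * n)              ≡⟨ cong (_* X ^ (Q * n)) (^-distribˡ-+-* k (S * a) (S′ * a)) ⟩
    k ^ (S * a) * k ^ (S′ * a) * X ^ (Q * n)        ∎
    where
    a*n≡ : a * n ≡ S * a + S′ * a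
    a*n≡ = trans (cong (a *_) (sym S+S′≡n)) (trans (*-comm a (S + S′)) (*-distribʳ-+ a S S′))

  combined : X ^ (S * a) * k ^ (Q * n) ≤ B * k ^ (S * a) * X ^ (Q * n)
  combined = *-cancelʳ-≤ _ _ (k ^ (S′ * a)) {{m^n≢0 k (S′ * a)}} (begin
    X ^ (S * a) * k ^ (Q * n) * k ^ (S′ * a)        ≡⟨ swap (X ^ (S * a)) (k ^ (Q * n)) (k ^ (S′ * a)) ⟩
    X ^ (S * a) * k ^ (S′ * a) * k ^ (Q * n)        ≤⟨ *-monoˡ-≤ (k ^ (Q * n)) powered ⟩
    B * Y ^ (n * a) * k ^ (Q * n)                   ≡⟨ *-assoc B (Y ^ (n * a)) (k ^ (Q * n)) ⟩
    B * (Y ^ (n * a) * k ^ (Q * n))                 ≤⟨ *-monoʳ-≤ B bases ⟩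
    B * (k ^ (S * a) * k ^ (S′ * a) * X ^ (Q * n))  ≡⟨ regroup B (k ^ (S * a)) (k ^ (S′ * a)) (X ^ (Q * n)) ⟩
    B * k ^ (S * a) * X ^ (Q * n) * k ^ (S′ * a)    ∎)
    where
    swap : ∀ x y z → x * y * z ≡ x * z * y
    swap = solve-∀
    regroup : ∀ w x y z → w * (x * y * z) ≡ w * x * z * y
    regroup = solve-∀

  split-^ : ∀ x → x ^ (S * a) ≡ x ^ n * x ^ (Q * n) * x ^ e
  split-^ x = trans (cong (x ^_) (sym eq)) (trans (^-distribˡ-+-* x (suc Q * n) e) (cong (_* x ^ e) (^-distribˡ-+-* x n (Q * n))))

  X^n≤ : X ^ n ≤ B * k ^ n
  X^n≤ = *-cancelʳ-≤ _ _ (k ^ e) {{m^n≢0 k e}} (≤-trans (*-monoʳ-≤ (X ^ n) (^-monoˡ-≤ e (m≤n+m k R)))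
    (*-cancelʳ-≤ _ _ (X ^ (Q * n)) {{m^n≢0 X (Q * n)}} (*-cancelʳ-≤ _ _ (k ^ (Q * n)) {{m^n≢0 k (Q * n)}} (begin
      X ^ n * X ^ e * X ^ (Q * n) * k ^ (Q * n)       ≡⟨ cong (_* k ^ (Q * n)) (swap (X ^ n) (X ^ e) (X ^ (Q * n))) ⟩
      X ^ n * X ^ (Q * n) * X ^ e * k ^ (Q * n)       ≡⟨ cong (_* k ^ (Q * n)) (split-^ X) ⟨
      X ^ (S * a) * k ^ (Q * n)                       ≤⟨ combined ⟩
      B * k ^ (S * a) * X ^ (Q * n)                   ≡⟨ cong (λ x → B * x * X ^ (Q * n)) (split-^ k) ⟩
      B * (k ^ n * k ^ (Q * n) * k ^ e) * X ^ (Q * n) ≡⟨ regroup B (k ^ n) (k ^ (Q * n)) (k ^ e) (X ^ (Q * n)) ⟩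
      B * k ^ n * k ^ e * X ^ (Q * n) * k ^ (Q * n)   ∎))))
    where
    swap : ∀ x y z → x * y * z ≡ x * z * y
    swap = solve-∀
    regroup : ∀ b x y z w → b * (x * y * z) * w ≡ b * x * z * w * y
    regroup = solve-∀

-- Asymptotics for length 2

shortPaths-asymp : ∀ r → KappaAsymp (2 + r) 2 (1 + r) (2 + r)
shortPaths-asymp r m@(suc m′) _ = N , λ n N≤n → lower n N≤n , upper n N≤n
  where
  R Q a k N₀ N : ℕ
  R = 2 + r
  -- The number of ties will be at most (Q+1)n/a with a = RQ - 1, which exceeds n/R by a relative
  -- error of order 1/Q. The value of `k` is chosen positive and at least a², as `compare-bases`
  -- requires.
  Q = 4 * m
  a = pred (R * Q)
  k = suc (a * a)
  beats : ∃[ N ] ∀ n → N ≤ n → n ^ (2 * a) * k ^ n < (R + k) ^ n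
  beats = exponential-beats-power R k (2 * a)
  N₀ = proj₁ beats
  N = N₀ + 4 * m * R

  1+a≡RQ : suc a ≡ R * Q
  1+a≡RQ = suc-pred (R * Q) {{m*n≢0 R Q}}

  Q<a : suc Q ≤ a
  Q<a = s≤s⁻¹ (begin
    2 + Q          ≤⟨ +-monoˡ-≤ Q (≤-trans (s≤s (s≤s z≤n)) (m≤m*n 4 m)) ⟩
    Q + Q          ≡⟨ cong (Q +_) (+-identityʳ Q) ⟨
    2 * Q          ≤⟨ *-monoˡ-≤ Q (m≤m+n 2 r) ⟩
    R * Q          ≡⟨ 1+a≡RQ ⟨
    suc a          ∎)
    where open ≤-Reasoning

  instance
    a≢0 : NonZero a
    a≢0 = >-nonZero (≤-trans (s≤s z≤n) Q<a)

  lower : ∀ n → N ≤ n → ∃[ t ] (Achievable R 2 n t × m′ * (1 + r) * n ≤ m * R * t)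
  lower n N≤n = t , (coloring , λ u v u≢v → shortPaths coloring u v u≢v (enough u v u≢v)) , large
    where
    open Potential n (suc r) k using (coloring; ties-bound)
    open ≤-Reasoning

    s t : ℕ
    s = suc Q * n / a
    t = n ∸ (s + 2)

    enough : ∀ u v → u ≢ v → t ≤ count (alternates coloring u v)
    enough u v u≢v = m≤n+o⇒m∸n≤o n (s + 2) (begin
      n                    ≤⟨ alternates-or-tie coloring u v ⟩
      alt + ties + 2       ≤⟨ +-monoˡ-≤ 2 (+-monoʳ-≤ alt ties≤s) ⟩
      alt + s + 2          ≡⟨ regroup alt s ⟩
      s + 2 + alt          ∎)
      where
      alt ties : ℕ
      alt  = count (alternates coloring u v)
      ties = count (tie coloring u v)
      ties≤s : ties ≤ s
      ties≤s = ≤-trans (≤-reflexive (sym (m*n/n≡m ties a))) (/-monoˡ-≤ a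
        (exponent-bound R Q a k n ties (count (not ∘ tie coloring u v)) 1+a≡RQ (n≤1+n _)
          (count-not (tie coloring u v)) (proj₂ beats n (≤-trans (m≤m+n N₀ _) N≤n)) (ties-bound u≢v)))
      regroup : ∀ x y → x + y + 2 ≡ y + 2 + x
      regroup = solve-∀

    s*a≤ : s * a ≤ suc Q * n
    s*a≤ = m/n*n≤m (suc Q * n) a

    s≤n : s ≤ n
    s≤n = *-cancelʳ-≤ s n a (begin
      s * a      ≤⟨ s*a≤ ⟩
      suc Q * n  ≤⟨ *-monoˡ-≤ n Q<a ⟩
      a * n      ≡⟨ *-comm a n ⟩
      n * a      ∎)

    -- Because `R * (4 * m)` equals `suc a`, four times the left side is s + sa + 8mR. The three
    -- terms are at most n, (1 + 4m)n and 2n, the last one by the choice of `N`.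
    mR[s+2]≤ : m * R * (s + 2) ≤ (m + 1) * n
    mR[s+2]≤ = *-cancelˡ-≤ 4 (begin
      4 * (m * R * (s + 2))              ≡⟨ expand m R s ⟩
      s * (R * (4 * m)) + 2 * (4 * m * R) ≡⟨ cong (λ x → s * x + 2 * (4 * m * R)) 1+a≡RQ ⟨
      s * suc a + 2 * (4 * m * R)        ≡⟨ cong (_+ 2 * (4 * m * R)) (*-suc s a) ⟩
      s + s * a + 2 * (4 * m * R)        ≤⟨ +-mono-≤ (+-mono-≤ s≤n s*a≤) (*-monoʳ-≤ 2 (≤-trans (m≤n+m (4 * m * R) N₀) N≤n)) ⟩
      n + suc Q * n + 2 * n              ≡⟨ collect m n ⟩
      4 * ((m + 1) * n)                  ∎)
      where
      expand : ∀ m R s → 4 * (m * R * (s + 2)) ≡ s * (R * (4 * m)) + 2 * (4 * m * R)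
      expand = solve-∀
      collect : ∀ m n → n + (1 + 4 * m) * n + 2 * n ≡ 4 * ((m + 1) * n)
      collect = solve-∀

    large : m′ * (1 + r) * n ≤ m * R * t
    large = +-cancelʳ-≤ (m * R * (s + 2)) _ _ (begin
      m′ * (1 + r) * n + m * R * (s + 2)       ≤⟨ +-monoʳ-≤ (m′ * (1 + r) * n) (≤-trans mR[s+2]≤ (m≤m+n _ (r * n))) ⟩
      m′ * (1 + r) * n + ((m + 1) * n + r * n) ≡⟨ collect m′ r n ⟩
      m * R * n                                ≤⟨ *-monoʳ-≤ (m * R) (m≤n+m∸n n (s + 2)) ⟩
      m * R * (s + 2 + t)                      ≡⟨ distribute (m * R) (s + 2) t ⟩
      m * R * t + m * R * (s + 2)              ∎)
      where
      collect : ∀ x r n → x * (1 + r) * n + ((1 + x + 1) * n + r * n) ≡ (1 + x) * (2 + r) * n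
      collect = solve-∀
      distribute : ∀ x y z → x * (y + z) ≡ x * z + x * y
      distribute = solve-∀

  upper : ∀ n → N ≤ n → ∀ t → Achievable R 2 n t → m * R * t ≤ (m + 1) * (1 + r) * n
  upper n N≤n t achievable = +-cancelʳ-≤ (m * n) _ _ (begin
    m * R * t + m * n                  ≡⟨ factorise m R t n ⟩
    m * (R * t + n)                    ≤⟨ *-monoʳ-≤ m (shortPaths-bound t (≤-trans (m≤m*n 2 m) 2m≤n) achievable) ⟩
    -- The error `m * R` is at most (1 + r) · 2m, which fits into the slack (1 + r)n because 2m ≤ n.
    m * (R * n + R)                    ≤⟨ m≤m+n _ (m * r) ⟩
    m * (R * n + R) + m * r            ≡⟨ expand m r n ⟩
    m * R * n + (1 + r) * (2 * m)      ≤⟨ +-monoʳ-≤ (m * R * n) (*-monoʳ-≤ (1 + r) 2m≤n) ⟩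
    m * R * n + (1 + r) * n            ≡⟨ collect m r n ⟩
    (m + 1) * (1 + r) * n + m * n      ∎)
    where
    open ≤-Reasoning
    2m≤n : 2 * m ≤ n
    2m≤n = begin
      2 * m      ≤⟨ *-monoˡ-≤ m {2} {4} (s≤s (s≤s z≤n)) ⟩
      4 * m      ≤⟨ m≤m*n (4 * m) R ⟩
      4 * m * R  ≤⟨ m≤n+m (4 * m * R) N₀ ⟩
      N          ≤⟨ N≤n ⟩
      n          ∎
    factorise : ∀ m R t n → m * R * t + m * n ≡ m * (R * t + n)
    factorise = solve-∀
    expand : ∀ m r n → m * ((2 + r) * n + (2 + r)) + m * r ≡ m * (2 + r) * n + (1 + r) * (2 * m)
    expand = solve-∀
    collect : ∀ m r n → m * (2 + r) * n + (1 + r) * n ≡ (m + 1) * (1 + r) * n + m * n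
    collect = solve-∀

theorem5p1 : (r : ℕ) → 2 ≤ r →
    KappaAsymp r 2 (r ∸ 1) r × ((ℓ : ℕ) → 3 ≤ ℓ → KappaAsymp r ℓ 1 (ℓ ∸ 1))
theorem5p1 (suc (suc r)) (s≤s (s≤s z≤n)) =
  shortPaths-asymp r , λ { (suc (suc (suc l))) (s≤s (s≤s (s≤s z≤n))) → longPaths-asymp r l }
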